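{- Let $k \geq 1$ and let $\lambda_1, \ldots, \lambda_k$ be coprime integers (i.e. $\gcd(\lambda_1,\ldots,\lambda_k)=1$). Then there is a constant $C$, depending only on $\lambda_1, \ldots, \lambda_k$, such that for every finite set $A \subset \mathbb{Z}$, $$|\lambda_1 \cdot A + \ldots + \lambda_k \cdot A| \geq (|\lambda_1| + \ldots + |\lambda_k|)\,|A| - C.$$
   Context: For finite sets $A, B$ of real numbers, $A + B = \{a+b : a \in A, b \in B\}$, and for a real number $d$, $d \cdot A = \{da : a \in A\}$. Sums of more than two sets are defined iteratively. -}

module Defs where

open import Data.Nat as ℕ using (ℕ)
open import Data.Integer as ℤ using (ℤ; +_; ∣_∣)
open import Data.Integer.GCD using (gcd)
open import Data.List as L using (List; []; _∷_; length; map; concatMap; deduplicate)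
open import Data.Vec as V using (Vec)

-- Finite sets of integers are represented by lists; the cardinality of the
-- set of elements of a list is the length of its deduplication.
card : List ℤ → ℕ
card xs = length (deduplicate ℤ._≟_ xs)

_·_ : ℤ → List ℤ → List ℤ
d · A = map (λ a → d ℤ.* a) A

_⊕_ : List ℤ → List ℤ → List ℤ
A ⊕ B = concatMap (λ a → map (λ b → a ℤ.+ b) B) A

-- λ₁·A + … + λₖ·A  (for k ≥ 1 this equals the iterated sumset;
-- the empty sum is {0})
dilSum : ∀ {k} → Vec ℤ k → List ℤ → List ℤ
dilSum V.[] A = + 0 ∷ []
dilSum (l V.∷ ls) A = (l · A) ⊕ dilSum ls A

gcdVec : ∀ {k} → Vec ℤ k → ℤ
gcdVec = V.foldr _ gcd (+ 0)

absSum : ∀ {k} → Vec ℤ k → ℕ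
absSum = V.foldr _ (λ l s → ∣ l ∣ ℕ.+ s) 0

{-# OPTIONS --safe #-}
module Submission where

-- Write S(A) = λ₁·A + … + λₖ·A, Λ = Σ|λᵢ| and dᵢ = gcd(λⱼ : j ≠ i), and induct on k.
--
-- If A meets every residue class mod every dᵢ, superadditivity of sumset cardinalities, applied in each
-- residue class mod Πdᵢ separately, gives (k−1)|S(A)| + O(1) ≥ Σᵢ dᵢ |Σ_{j≠i} λⱼ·A|. By the induction
-- hypothesis the i-th summand is at least (Λ − |λᵢ|)|A| − O(1), and these bounds add up to (k−1)Λ|A| − O(1).
--
-- For general A one improves a bound |S(A)| ≥ c|A| − O(1) to c + δ with a fixed δ > 0 while c < Λ. After
-- normalising so that the differences of A generate ℤ, split A into its classes B mod dᵢ. The sets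
-- λᵢ·B + Σ_{j≠i} λⱼ·A ⊇ S(B) are disjoint for distinct B. Either such a set contains many elements in a class
-- (mod dᵢ² or mod some dₗ) that S(B) avoids, which is a gain, or B, rescaled, meets all classes mod dᵢ;
-- doing this for one i after the other ends in the first case.

open import Defs
open import Data.Nat as ℕ using (ℕ; zero; suc)
open import Data.Integer as ℤ using (ℤ; +_; -[1+_]; _+_; _*_; _-_; -_) renaming (∣_∣ to abs)
open import Data.List using (List; []; _∷_; length; map; filter; deduplicate; upTo; cartesianProduct) renaming (_++_ to _⊹_)
open import Data.Vec as V using (Vec; lookup)
open import Data.Product using (∃; _×_; _,_; proj₁; proj₂)
open import Data.Sum using (_⊎_; inj₁; inj₂; [_,_]′)
open import Data.Empty using (⊥; ⊥-elim)
open import Data.Fin using (Fin; zero; suc; toℕ; fromℕ<; punchIn)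
open import Data.Vec.Functional using (Vector; removeAt; insertAt; updateAt) renaming (_∷_ to _∷ᶠ_)
open import Function using (id; _∘_)
open import Relation.Nullary using (¬_; Dec; yes; no; contradiction; ¬?)
open import Relation.Nullary.Decidable using (decidable-stable)
open import Relation.Unary using (Decidable)
open import Relation.Binary.Definitions using (tri<; tri≈; tri>)
open import Relation.Binary.PropositionalEquality using (_≡_; _≢_; refl; sym; trans; cong; cong₂; subst; module ≡-Reasoning)
import Data.Nat.Properties as ℕₚ
import Data.Nat.Divisibility as ℕ∣
import Data.Nat.GCD as GCD
import Data.Integer.Properties as ℤₚ
import Data.Fin.Properties as Finₚ
import Data.List.Properties as Listₚ
open import Data.Integer.Divisibility.Signed
open import Data.Integer.DivMod using (_%ℕ_; _/ℕ_; n%ℕd<d; a≡a%ℕn+[a/ℕn]*n)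
open import Data.Integer.Tactic.RingSolver using (solve-∀)
open import Data.Nat.Tactic.RingSolver using () renaming (solve-∀ to ℕsolve-∀)
open import Data.Vec.Functional.Properties using (insertAt-lookup; insertAt-punchIn; updateAt-updates; updateAt-minimal)
open import Data.List.Relation.Unary.Any as Any using (here; there)
import Data.List.Relation.Unary.All as All
open import Data.List.Relation.Unary.All.Properties.Core using (¬All⇒Any¬)
open import Data.List.Relation.Unary.AllPairs using (_∷_)
open import Data.List.Relation.Unary.Unique.Propositional using (Unique)
open import Data.List.Relation.Unary.Unique.Propositional.Properties using (++⁺; cartesianProduct⁺; upTo⁺) renaming (filter⁺ to unique-filter⁺)
open import Data.List.Relation.Unary.Unique.DecPropositional.Properties ℤ._≟_ using (deduplicate-!)
open import Data.List.Membership.Propositional using (_∈_; find)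
open import Data.List.Membership.Propositional.Properties
open import Algebra.Properties.AbelianGroup ℤₚ.+-0-abelianGroup using (∙-cancelˡ; ∙-cancelʳ)
open import Algebra.Properties.CommutativeMonoid.Sum ℤₚ.+-0-commutativeMonoid using (sum; sum-remove; sum-cong-≗)
import Algebra.Properties.Semiring.Sum ℕₚ.+-*-semiring as Σℕ

-- Cardinalities

-- Removing a coefficient destroys coprimality, so the induction runs over all coefficient vectors,
-- with the factor gcd(λ) in front of |S(A)|; for the i-th subsum this factor is dᵢ, exactly the
-- multiplicity with which superadditivity counts it. The elements gained from a class B may stem
-- from a tiny part of B. Such a part is deleted and the argument repeated on the rest with a larger
-- gain as the target, at most dᵢ times, once for each class mod dᵢ of the rescaled B. With K = Λ +
-- 2 the thresholds are powers of 1/K, and E = K^(Σdᵢ) is a common denominator for all i, so δ = 1/E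
-- and the number Λ·E of rounds from c = 0 to c = Λ are independent of A. Rescaling for one modulus
-- may spoil another. The conditions are therefore dropped in a fixed order: the bound is known for
-- sets that meet all classes mod dₗ for l ≥ i, and is extended to those that do so for l > i. A
-- class B that fails this for some l > i has thereby produced a gain.

InjectiveOn : {B : Set} → (B → ℤ) → List B → Set
InjectiveOn f xs = ∀ {x y} → x ∈ xs → y ∈ xs → f x ≡ f y → x ≡ y

length-injectiveOn : ∀ {B : Set} {xs : List B} {ys} (f : B → ℤ) → Unique xs → InjectiveOn f xs →
  (∀ {x} → x ∈ xs → f x ∈ ys) → length xs ℕ.≤ length ys
length-injectiveOn {xs = []} f u inj into = ℕ.z≤n
length-injectiveOn {xs = x ∷ xs} f (x∉ ∷ u) inj into with ∈-∃++ (into (here refl))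
... | ps , qs , refl = subst (suc (length xs) ℕ.≤_) (sym (Listₚ.length-++-sucʳ ps (f x) qs))
        (ℕ.s≤s (length-injectiveOn f u (λ p q → inj (there p) (there q)) into′))
  where
  into′ : ∀ {y} → y ∈ xs → f y ∈ ps ⊹ qs
  into′ {y} y∈ with ∈-++⁻ ps (into (there y∈))
  ... | inj₁ p = ∈-++⁺ˡ p
  ... | inj₂ (there q) = ∈-++⁺ʳ ps q
  ... | inj₂ (here e) = ⊥-elim (All.lookup x∉ y∈ (inj (here refl) (there y∈) (sym e)))

length≤card : ∀ {B : Set} {xs : List B} {ys} (f : B → ℤ) → Unique xs → InjectiveOn f xs →
  (∀ {x} → x ∈ xs → f x ∈ ys) → length xs ℕ.≤ card ys
length≤card f u inj into = length-injectiveOn f u inj (∈-deduplicate⁺ ℤ._≟_ ∘ into)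

card-injectiveOn : ∀ {xs ys} (f : ℤ → ℤ) → InjectiveOn f xs →
  (∀ {x} → x ∈ xs → f x ∈ ys) → card xs ℕ.≤ card ys
card-injectiveOn {xs} f inj into =
  length≤card f (deduplicate-! xs) (λ p q → inj (∈-deduplicate⁻ ℤ._≟_ xs p) (∈-deduplicate⁻ ℤ._≟_ xs q))
    (into ∘ ∈-deduplicate⁻ ℤ._≟_ xs)

card-⊆ : ∀ {xs ys} → (∀ {x} → x ∈ xs → x ∈ ys) → card xs ℕ.≤ card ys
card-⊆ = card-injectiveOn id (λ _ _ e → e)

card-disjoint : ∀ {xs ys zs} → (∀ {x} → x ∈ xs → x ∈ zs) → (∀ {x} → x ∈ ys → x ∈ zs) →
  (∀ {x} → x ∈ xs → x ∈ ys → ⊥) → card xs ℕ.+ card ys ℕ.≤ card zs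
card-disjoint {xs} {ys} xs⊆ ys⊆ disj = subst (ℕ._≤ _) (Listₚ.length-++ (deduplicate ℤ._≟_ xs))
  (length≤card id (++⁺ (deduplicate-! xs) (deduplicate-! ys) λ (p , q) → disj (∈x p) (∈y q)) (λ _ _ e → e)
    ([ xs⊆ ∘ ∈x , ys⊆ ∘ ∈y ]′ ∘ ∈-++⁻ (deduplicate ℤ._≟_ xs)))
  where
  ∈x = ∈-deduplicate⁻ ℤ._≟_ xs
  ∈y = ∈-deduplicate⁻ ℤ._≟_ ys

card-cover : ∀ {xs ys zs} → (∀ {x} → x ∈ zs → x ∈ xs ⊎ x ∈ ys) → card zs ℕ.≤ card xs ℕ.+ card ys
card-cover {xs} {ys} {zs} cov = subst (card zs ℕ.≤_) (Listₚ.length-++ (deduplicate ℤ._≟_ xs))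
  (length-injectiveOn id (deduplicate-! zs) (λ _ _ e → e)
    ([ ∈-++⁺ˡ ∘ ∈-deduplicate⁺ ℤ._≟_ , ∈-++⁺ʳ _ ∘ ∈-deduplicate⁺ ℤ._≟_ ]′ ∘ cov ∘ ∈-deduplicate⁻ ℤ._≟_ zs))

card-map≤ : ∀ (f : ℤ → ℤ) xs → card (map f xs) ℕ.≤ card xs
card-map≤ f xs = subst (card (map f xs) ℕ.≤_) (Listₚ.length-map f (deduplicate ℤ._≟_ xs))
  (length-injectiveOn id (deduplicate-! (map f xs)) (λ _ _ e → e) λ p →
    let x , x∈ , e = ∈-map⁻ f (∈-deduplicate⁻ ℤ._≟_ (map f xs) p)
    in subst (_∈ map f (deduplicate ℤ._≟_ xs)) (sym e) (∈-map⁺ f (∈-deduplicate⁺ ℤ._≟_ x∈)))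

∈-⊕⁺ : ∀ {A B a b} → a ∈ A → b ∈ B → a ℤ.+ b ∈ A ⊕ B
∈-⊕⁺ {a = a} a∈ b∈ = ∈-concatMap⁺ (λ a → map (λ b → a ℤ.+ b) _) (Any.map (λ { refl → ∈-map⁺ (λ b → a ℤ.+ b) b∈ }) a∈)

∈-⊕⁻ : ∀ A {B u} → u ∈ A ⊕ B → ∃ λ a → ∃ λ b → a ∈ A × b ∈ B × u ≡ a ℤ.+ b
∈-⊕⁻ A p with find (∈-concatMap⁻ _ {xs = A} p)
... | a , a∈ , q with ∈-map⁻ _ q
...   | b , b∈ , e = a , b , a∈ , b∈ , e

-- Subgroups of ℤ and greatest common divisors

bézout-difference : ∀ {g} u v m n → g ℕ.+ v ℕ.* n ≡ u ℕ.* m → + u * + m - + v * + n ≡ + g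
bézout-difference {g} u v m n eq = trans
  (cong (_- + v * + n) (trans (sym (ℤₚ.pos-* u m)) (trans (cong +_ (sym eq)) (cong (λ z → + g + z) (ℤₚ.pos-* v n)))))
  (cancel (+ g) (+ v * + n))
  where cancel : ∀ a b → (a + b) - b ≡ a
        cancel = solve-∀

-- Bézout's identity is used only in the form that a gcd lies in every subgroup containing its
-- arguments. Each consequence is then obtained by a suitable choice of `P`.
record IsSubgroup (P : ℤ → Set) : Set where
  field
    0-closed : P (+ 0)
    +-closed : ∀ {x y} → P x → P y → P (x + y)
    neg-closed : ∀ {x} → P x → P (- x)

  sub-closed : ∀ {x y} → P x → P y → P (x - y)
  sub-closed p q = +-closed p (neg-closed q)

  ℕ*-closed : ∀ n {x} → P x → P (+ n * x)
  ℕ*-closed zero p = 0-closed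
  ℕ*-closed (suc n) {x} p = subst P (sym (ℤₚ.suc-* (+ n) x)) (+-closed p (ℕ*-closed n p))

  *-closed : ∀ n {x} → P x → P (n * x)
  *-closed (+ n) p = ℕ*-closed n p
  *-closed -[1+ n ] {x} p = subst P (ℤₚ.neg-distribˡ-* (+ suc n) x) (neg-closed (ℕ*-closed (suc n) p))

  ∣∣-closed : ∀ {x} → P x → P (+ abs x)
  ∣∣-closed {+ n} p = p
  ∣∣-closed { -[1+ n ]} p = neg-closed p

  gcd-closed : ∀ {x y} → P x → P y → P (+ GCD.gcd (abs x) (abs y))
  gcd-closed {x} {y} p q with GCD.Bézout.identity (GCD.gcd-GCD (abs x) (abs y))
  ... | GCD.Bézout.+- u v eq = subst P (bézout-difference u v (abs x) (abs y) eq)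
    (sub-closed (ℕ*-closed u (∣∣-closed p)) (ℕ*-closed v (∣∣-closed q)))
  ... | GCD.Bézout.-+ u v eq = subst P (bézout-difference v u (abs y) (abs x) eq)
    (sub-closed (ℕ*-closed v (∣∣-closed q)) (ℕ*-closed u (∣∣-closed p)))

∣-subgroup : ∀ m → IsSubgroup (m ∣_)
∣-subgroup m = record { 0-closed = divides (+ 0) refl ; +-closed = ∣m∣n⇒∣m+n ; neg-closed = ∣m⇒∣-m }

∣*-subgroup : ∀ m y → IsSubgroup (λ x → m ∣ x * y)
∣*-subgroup m y = record
  { 0-closed = divides (+ 0) refl
  ; +-closed = λ {a} {b} p q → subst (m ∣_) (sym (ℤₚ.*-distribʳ-+ y a b)) (∣m∣n⇒∣m+n p q)
  ; neg-closed = λ {a} p → subst (m ∣_) (ℤₚ.neg-distribˡ-* a y) (∣m⇒∣-m p) }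

gcd-∣ˡ : ∀ x n → + GCD.gcd (abs x) n ∣ x
gcd-∣ˡ x n = ∣ᵤ⇒∣ (GCD.gcd[m,n]∣m (abs x) n)

gcdᶠ : ∀ {k} → (Fin k → ℤ) → ℕ
gcdᶠ {zero} λs = 0
gcdᶠ {suc k} λs = GCD.gcd (abs (λs zero)) (gcdᶠ (λs ∘ suc))

gcdᶠ-∣ : ∀ {k} (λs : Fin k → ℤ) i → + gcdᶠ λs ∣ λs i
gcdᶠ-∣ λs zero = gcd-∣ˡ (λs zero) _
gcdᶠ-∣ λs (suc i) = ∣-trans (∣ᵤ⇒∣ (GCD.gcd[m,n]∣n (abs (λs zero)) _)) (gcdᶠ-∣ (λs ∘ suc) i)

gcdᶠ-closed : ∀ {k P} → IsSubgroup P → (λs : Fin k → ℤ) → (∀ i → P (λs i)) → P (+ gcdᶠ λs)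
gcdᶠ-closed {zero} G λs p = IsSubgroup.0-closed G
gcdᶠ-closed {suc k} G λs p = IsSubgroup.gcd-closed G (p zero) (gcdᶠ-closed G (λs ∘ suc) (p ∘ suc))

gcdˡ : List ℤ → ℕ
gcdˡ [] = 0
gcdˡ (x ∷ xs) = GCD.gcd (abs x) (gcdˡ xs)

gcdˡ-∣ : ∀ {xs x} → x ∈ xs → + gcdˡ xs ∣ x
gcdˡ-∣ {x ∷ xs} (here refl) = gcd-∣ˡ x _
gcdˡ-∣ {x ∷ xs} (there p) = ∣-trans (∣ᵤ⇒∣ (GCD.gcd[m,n]∣n (abs x) _)) (gcdˡ-∣ p)

gcdˡ-closed : ∀ {P} → IsSubgroup P → ∀ xs → (∀ {x} → x ∈ xs → P x) → P (+ gcdˡ xs)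
gcdˡ-closed G [] p = IsSubgroup.0-closed G
gcdˡ-closed G (x ∷ xs) p = IsSubgroup.gcd-closed G (p (here refl)) (gcdˡ-closed G xs (p ∘ there))

-- Residue classes

∣-sym : ∀ {m} x y → m ∣ x - y → m ∣ y - x
∣-sym {m} x y p = subst (m ∣_) (flip x y) (∣m⇒∣-m p)
  where flip : ∀ x y → - (x - y) ≡ y - x
        flip = solve-∀

∣-chain : ∀ {m} x y z → m ∣ x - y → m ∣ y - z → m ∣ x - z
∣-chain {m} x y z p q = subst (m ∣_) (tele x y z) (∣m∣n⇒∣m+n p q)
  where tele : ∀ x y z → (x - y) + (y - z) ≡ x - z
        tele = solve-∀

∣-residue : ∀ d .{{_ : ℕ.NonZero d}} x → + d ∣ x - + (x %ℕ d)
∣-residue d x = divides (x /ℕ d) (trans (cong (_- + (x %ℕ d)) (a≡a%ℕn+[a/ℕn]*n x d)) (cancel (+ (x %ℕ d)) _))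
  where cancel : ∀ a b → (a + b) - a ≡ b
        cancel = solve-∀

residue-unique : ∀ {d r s} → r ℕ.< d → s ℕ.< d → + d ∣ + r - + s → r ≡ s
residue-unique {d} {r} {s} r<d s<d p = [ (λ r≤s → ordered r≤s s<d (∣-sym (+ r) (+ s) p)) , (λ s≤r → sym (ordered s≤r r<d p)) ]′ (ℕₚ.≤-total r s)
  where
  ordered : ∀ {r s} → r ℕ.≤ s → s ℕ.< d → + d ∣ + s - + r → r ≡ s
  ordered {r} {s} r≤s s<d p
    with s ℕ.∸ r in eq | subst (d ℕ∣.∣_) (cong abs (trans (ℤₚ.m-n≡m⊖n s r) (ℤₚ.⊖-≥ r≤s))) (∣⇒∣ᵤ p)
  ... | zero | _ = ℕₚ.≤-antisym r≤s (ℕₚ.m∸n≡0⇒m≤n eq)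
  ... | suc n | q = contradiction q (ℕ∣.>⇒∤ (subst (ℕ._< d) eq (ℕₚ.≤-<-trans (ℕₚ.m∸n≤m s r) s<d)))

%ℕ-cong : ∀ d .{{_ : ℕ.NonZero d}} x y → + d ∣ x - y → x %ℕ d ≡ y %ℕ d
%ℕ-cong d x y p = residue-unique (n%ℕd<d x d) (n%ℕd<d y d)
  (∣-chain (+ (x %ℕ d)) y _ (∣-chain (+ (x %ℕ d)) x y (∣-sym x _ (∣-residue d x)) p) (∣-residue d y))

HitsAll : ℕ → List ℤ → Set
HitsAll d A = ∀ m → ∃ λ a → a ∈ A × + d ∣ m - a

Misses : ℕ → List ℤ → Set
Misses d A = ∃ λ m → ∀ {a} → a ∈ A → ¬ + d ∣ m - a

hitsAll? : ∀ d .{{_ : ℕ.NonZero d}} A → HitsAll d A ⊎ Misses d A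
hitsAll? d A with All.all? (λ r → Any.any? (λ a → + d ∣? + r - a) A) (upTo d)
... | yes p = inj₁ λ m →
  let a , a∈ , q = find (All.lookup p (∈-upTo⁺ (n%ℕd<d m d))) in a , a∈ , ∣-chain m _ a (∣-residue d m) q
... | no ¬p with find (¬All⇒Any¬ (λ r → Any.any? (λ a → + d ∣? + r - a) A) (upTo d) ¬p)
...   | r , _ , miss = inj₂ (+ r , λ a∈ q → miss (Any.map (λ { refl → q }) a∈))

-- An affine map x ↦ r + qx whose image hits the class of r + 1 has q invertible mod d.
hitsAll-affine⁻ : ∀ d r q X → HitsAll d (map (λ x → r + q * x) X) → HitsAll d X
hitsAll-affine⁻ d r q X h y with h (r + + 1) | h (r + q * y)
... | a , a∈ , p | b , b∈ , s with ∈-map⁻ _ a∈ | ∈-map⁻ _ b∈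
...   | x , _ , refl | z , z∈ , refl = z , z∈ ,
  subst (+ d ∣_) (ident r q x y z) (∣m∣n⇒∣m+n (∣n⇒∣m*n (y - z) p) (∣n⇒∣m*n x s))
  where ident : ∀ r q x y z → (y - z) * ((r + + 1) - (r + q * x)) + x * ((r + q * y) - (r + q * z)) ≡ y - z
        ident = solve-∀

affine-preimage : ∀ q r A → (∀ {a} → a ∈ A → q ∣ a - r) → ∃ λ X → A ≡ map (λ x → r + q * x) X
affine-preimage q r [] p = [] , refl
affine-preimage q r (a ∷ A) p with p (here refl) | affine-preimage q r A (p ∘ there)
... | divides x eq | X , refl = x ∷ X , cong (_∷ _) (trans (ident a r) (cong (λ z → r + z) (trans eq (ℤₚ.*-comm x q))))
  where ident : ∀ a r → a ≡ r + (a - r)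
        ident = solve-∀

-- The differences of `A` generate ℤ; quantifying over all subgroups that contain them avoids
-- constructing the generated one.
Generates : List ℤ → Set₁
Generates A = ∀ {P} → IsSubgroup P → (∀ {a b} → a ∈ A → b ∈ A → P (a - b)) → P (+ 1)

normalise : ∀ {A a₀} → a₀ ∈ A →
  (∀ {a} → a ∈ A → a ≡ a₀) ⊎
  (∃ λ q → ∃ λ X → ℕ.NonZero q × A ≡ map (λ x → a₀ + + q * x) X × Generates X)
normalise {A} {a₀} a₀∈ with gcdˡ (map (_- a₀) A) in eq
... | zero = inj₁ λ {a} a∈ → trans (ident a a₀) (trans (cong (_+ a₀)
               (0∣⇒≡0 (subst (λ g → + g ∣ a - a₀) eq (gcdˡ-∣ (∈-map⁺ (_- a₀) a∈))))) (ℤₚ.+-identityˡ a₀))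
  where ident : ∀ a b → a ≡ (a - b) + b
        ident = solve-∀
... | q@(suc _) with affine-preimage (+ q) a₀ A (λ {a} a∈ → subst (λ g → + g ∣ a - a₀) eq (gcdˡ-∣ (∈-map⁺ (_- a₀) a∈)))
...   | X , refl = inj₂ (q , X , _ , refl , gen)
  where
  gen : Generates X
  -- The multiples `+ q * z` with `P z` form a subgroup containing all `a - a₀`, hence their gcd
  -- `q`; cancelling `q` leaves 1 in `P`.
  gen {P} G diff with gcdˡ-closed {P = λ y → ∃ λ z → P z × y ≡ + q * z} multiples (map (_- a₀) A) member
    where
    open IsSubgroup G
    multiples : IsSubgroup (λ y → ∃ λ z → P z × y ≡ + q * z)
    multiples = record
      { 0-closed = + 0 , 0-closed , sym (ℤₚ.*-zeroʳ (+ q))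
      ; +-closed = λ { (z , p , refl) (z′ , p′ , refl) → z + z′ , +-closed p p′ , sym (ℤₚ.*-distribˡ-+ (+ q) z z′) }
      ; neg-closed = λ { (z , p , refl) → - z , neg-closed p , ℤₚ.neg-distribʳ-* (+ q) z } }
    member : ∀ {y} → y ∈ map (_- a₀) A → ∃ λ z → P z × y ≡ + q * z
    member y∈ with ∈-map⁻ (_- a₀) y∈
    ... | a , a∈ , refl with ∈-map⁻ _ a∈ | ∈-map⁻ _ a₀∈
    ...   | x , x∈ , refl | x₀ , x₀∈ , eq₀ = x - x₀ , diff x∈ x₀∈ ,
      trans (cong (λ r → (a₀ + + q * x) - r) eq₀) (ident a₀ (+ q) x x₀)
      where ident : ∀ r q x y → (r + q * x) - (r + q * y) ≡ q * (x - y)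
            ident = solve-∀
  ... | z , p , e = subst P (sym (ℤₚ.*-cancelˡ-≡ (+ q) (+ 1) z (trans (ℤₚ.*-identityʳ (+ q)) (trans (cong +_ (sym eq)) e)))) p

class : ℕ → ℤ → List ℤ → List ℤ
class d x = filter (λ y → + d ∣? y - x)

others : ℕ → ℤ → List ℤ → List ℤ
others d x = filter (λ y → ¬? (+ d ∣? y - x))

card-class-others : ∀ d x X → card X ℕ.≤ card (class d x X) ℕ.+ card (others d x X)
card-class-others d x X = card-cover λ {y} y∈ → split y y∈ (+ d ∣? y - x)
  where
  split : ∀ y → y ∈ X → Dec (+ d ∣ y - x) → y ∈ class d x X ⊎ y ∈ others d x X
  split y y∈ (yes p) = inj₁ (∈-filter⁺ _ y∈ p)
  split y y∈ (no p) = inj₂ (∈-filter⁺ _ y∈ p)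

-- The length of `R` bounds the number of nonempty classes; it is the measure for recursions that
-- split off one class at a time.
Covers : ℕ → List ℤ → List ℤ → Set
Covers d R X = ∀ {x} → x ∈ X → ∃ λ ρ → ρ ∈ R × + d ∣ x - ρ

residues : ℕ → List ℤ
residues d = map +_ (upTo d)

length-residues : ∀ d → length (residues d) ≡ d
length-residues d = trans (Listₚ.length-map +_ (upTo d)) (Listₚ.length-upTo d)

residues-covers : ∀ d .{{_ : ℕ.NonZero d}} X → Covers d (residues d) X
residues-covers d X {x} _ = + (x %ℕ d) , ∈-map⁺ +_ (∈-upTo⁺ (n%ℕd<d x d)) , ∣-residue d x

covers-others : ∀ d {R X x} → Covers d R X → x ∈ X →
  ∃ λ R′ → length R ≡ suc (length R′) × Covers d R′ (others d x X)
covers-others d {R} {X} {x} cov x∈ with cov x∈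
... | ρ , ρ∈ , p with ∈-∃++ ρ∈
...   | ps , qs , refl = ps ⊹ qs , Listₚ.length-++-sucʳ ps ρ qs , cov′
  where
  cov′ : Covers d (ps ⊹ qs) (others d x X)
  cov′ {y} y∈ with ∈-filter⁻ (λ y → ¬? (+ d ∣? y - x)) y∈
  ... | y∈X , ¬p with cov y∈X
  ...   | σ , σ∈ , q with ∈-++⁻ ps σ∈
  ...     | inj₁ r = σ , ∈-++⁺ˡ r , q
  ...     | inj₂ (there r) = σ , ∈-++⁺ʳ ps r , q
  ...     | inj₂ (here refl) = ⊥-elim (¬p (∣-chain y ρ x q (∣-sym x ρ p)))

-- Sums of dilates

dil : ∀ {k} → Vector ℤ k → List ℤ → List ℤ
dil {zero} λs A = + 0 ∷ []
dil {suc k} λs A = (λs zero · A) ⊕ dil (λs ∘ suc) A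

comb : ∀ {k} → Vector ℤ k → Vector ℤ k → ℤ
comb λs a = sum λ i → λs i * a i

∈-dil⁺ : ∀ {k} (λs : Vector ℤ k) {A} a → (∀ i → a i ∈ A) → comb λs a ∈ dil λs A
∈-dil⁺ {zero} λs a a∈ = here refl
∈-dil⁺ {suc k} λs a a∈ = ∈-⊕⁺ (∈-map⁺ (λ x → λs zero * x) (a∈ zero)) (∈-dil⁺ (λs ∘ suc) (a ∘ suc) (a∈ ∘ suc))

∈-dil⁻ : ∀ {k} (λs : Vector ℤ k) {A u} → u ∈ dil λs A → ∃ λ a → (∀ i → a i ∈ A) × u ≡ comb λs a
∈-dil⁻ {zero} λs (here refl) = (λ ()) , (λ ()) , refl
∈-dil⁻ {suc k} λs {A} u∈ with ∈-⊕⁻ (λs zero · A) u∈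
... | _ , s , y∈ , s∈ , refl with ∈-map⁻ _ y∈ | ∈-dil⁻ (λs ∘ suc) s∈
...   | x , x∈ , refl | a , a∈ , refl = x ∷ᶠ a , (λ { zero → x∈ ; (suc i) → a∈ i }) , refl

comb-cong : ∀ {k} (λs : Vector ℤ k) {a b} → (∀ i → a i ≡ b i) → comb λs a ≡ comb λs b
comb-cong λs e = sum-cong-≗ λ i → cong (λs i *_) (e i)

comb-remove : ∀ {k} (λs a : Vector ℤ (suc k)) i → comb λs a ≡ λs i * a i + comb (removeAt λs i) (removeAt a i)
comb-remove λs a i = sum-remove {i = i} λ j → λs j * a j

comb-insert : ∀ {k} (λs : Vector ℤ (suc k)) a i x →
  comb λs (insertAt a i x) ≡ λs i * x + comb (removeAt λs i) a
comb-insert λs a i x = trans (comb-remove λs (insertAt a i x) i)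
  (cong₂ (λ y s → λs i * y + s) (insertAt-lookup a i x) (comb-cong (removeAt λs i) (insertAt-punchIn a i x)))

comb-affine : ∀ {k} (λs : Vector ℤ k) r q a → comb λs (λ i → r + q * a i) ≡ comb λs (λ _ → r) + q * comb λs a
comb-affine {zero} λs r q a = sym (trans (ℤₚ.+-identityˡ _) (ℤₚ.*-zeroʳ q))
comb-affine {suc k} λs r q a = trans (cong (λ z → λs zero * (r + q * a zero) + z) (comb-affine (λs ∘ suc) r q (a ∘ suc)))
  (ident (λs zero) r q (a zero) _ _)
  where ident : ∀ l r q a s t → l * (r + q * a) + (s + q * t) ≡ (l * r + s) + q * (l * a + t)
        ident = solve-∀

comb-scale : ∀ {k} (λs μs : Vector ℤ k) g a → (∀ i → λs i ≡ g * μs i) → comb λs a ≡ g * comb μs a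
comb-scale {zero} λs μs g a e = sym (ℤₚ.*-zeroʳ g)
comb-scale {suc k} λs μs g a e = trans
  (cong₂ (λ l z → l * a zero + z) (e zero) (comb-scale (λs ∘ suc) (μs ∘ suc) g (a ∘ suc) (e ∘ suc)))
  (ident g (μs zero) (a zero) _)
  where ident : ∀ g m a s → (g * m) * a + g * s ≡ g * (m * a + s)
        ident = solve-∀

∣-comb-difference : ∀ {k m} (λs a b : Vector ℤ k) → (∀ i → m ∣ λs i * (a i - b i)) → m ∣ comb λs a - comb λs b
∣-comb-difference {zero} λs a b h = divides (+ 0) refl
∣-comb-difference {suc k} {m} λs a b h = subst (m ∣_) (ident (λs zero) (a zero) (b zero) _ _)
  (∣m∣n⇒∣m+n (h zero) (∣-comb-difference (λs ∘ suc) (a ∘ suc) (b ∘ suc) (h ∘ suc)))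
  where ident : ∀ l a b s t → l * (a - b) + (s - t) ≡ (l * a + s) - (l * b + t)
        ident = solve-∀

∣-comb : ∀ {k m} (λs a : Vector ℤ k) → (∀ i → m ∣ λs i) → m ∣ comb λs a
∣-comb {zero} λs a h = divides (+ 0) refl
∣-comb {suc k} λs a h = ∣m∣n⇒∣m+n (∣m⇒∣m*n (a zero) (h zero)) (∣-comb (λs ∘ suc) (a ∘ suc) (h ∘ suc))

∣-comb-coordinate : ∀ {k m} (λs a : Vector ℤ (suc k)) i → (∀ j → m ∣ removeAt λs i j) → m ∣ comb λs a - λs i * a i
∣-comb-coordinate {m = m} λs a i h = subst (m ∣_)
  (trans (ident (λs i * a i) _) (cong (_- λs i * a i) (sym (comb-remove λs a i))))
  (∣-comb (removeAt λs i) (removeAt a i) h)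
  where ident : ∀ x s → s ≡ (x + s) - x
        ident = solve-∀

card-dil-affine : ∀ {k} (λs : Vector ℤ k) r q .{{_ : ℤ.NonZero q}} X →
  card (dil λs X) ℕ.≤ card (dil λs (map (λ x → r + q * x) X))
card-dil-affine λs r q X = card-injectiveOn (λ y → comb λs (λ _ → r) + q * y)
  (λ _ _ e → ℤₚ.*-cancelˡ-≡ q _ _ (∙-cancelˡ (comb λs (λ _ → r)) _ _ e)) into
  where
  into : ∀ {y} → y ∈ dil λs X → comb λs (λ _ → r) + q * y ∈ dil λs (map (λ x → r + q * x) X)
  into y∈ with ∈-dil⁻ λs y∈
  ... | a , a∈ , refl = subst (_∈ dil λs (map (λ x → r + q * x) X)) (comb-affine λs r q a)
    (∈-dil⁺ λs (λ i → r + q * a i) (λ i → ∈-map⁺ (λ x → r + q * x) (a∈ i)))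

card-dil-scale : ∀ {k} (λs μs : Vector ℤ k) g .{{_ : ℤ.NonZero g}} → (∀ i → λs i ≡ g * μs i) → ∀ A →
  card (dil μs A) ℕ.≤ card (dil λs A)
card-dil-scale λs μs g e A = card-injectiveOn (g *_) (λ _ _ → ℤₚ.*-cancelˡ-≡ g _ _) into
  where
  into : ∀ {y} → y ∈ dil μs A → g * y ∈ dil λs A
  into y∈ with ∈-dil⁻ μs y∈
  ... | a , a∈ , refl = subst (_∈ dil λs A) (comb-scale λs μs g a e) (∈-dil⁺ λs a a∈)

-- For `B` inside `A` this set lies between `dil λs B` and `dil λs A`; it is where the gain over
-- `dil λs B` is found.
mixed : ∀ {k} → Vector ℤ (suc k) → Fin (suc k) → List ℤ → List ℤ → List ℤ
mixed λs i B A = (λs i · B) ⊕ dil (removeAt λs i) A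

module _ {k} (λs : Vector ℤ (suc k)) (i : Fin (suc k)) where

  ∈-mixed⁺ : ∀ {A B b s} → b ∈ B → s ∈ dil (removeAt λs i) A → λs i * b + s ∈ mixed λs i B A
  ∈-mixed⁺ b∈ s∈ = ∈-⊕⁺ (∈-map⁺ (λ x → λs i * x) b∈) s∈

  ∈-mixed⁻ : ∀ {A B u} → u ∈ mixed λs i B A →
    ∃ λ b → ∃ λ s → b ∈ B × s ∈ dil (removeAt λs i) A × u ≡ λs i * b + s
  ∈-mixed⁻ {B = B} u∈ with ∈-⊕⁻ (λs i · B) u∈
  ... | _ , s , y∈ , s∈ , refl with ∈-map⁻ _ y∈
  ...   | b , b∈ , refl = b , s , b∈ , s∈ , refl

  mixed⊆dil : ∀ {A B} → (∀ {b} → b ∈ B → b ∈ A) → ∀ {u} → u ∈ mixed λs i B A → u ∈ dil λs A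
  mixed⊆dil {A} B⊆A u∈ with ∈-mixed⁻ u∈
  ... | b , s , b∈ , s∈ , refl with ∈-dil⁻ (removeAt λs i) s∈
  ...   | a , a∈ , refl = subst (_∈ dil λs A) (comb-insert λs a i b) (∈-dil⁺ λs (insertAt a i b) member)
    where
    member : ∀ j → insertAt a i b j ∈ A
    member j with i Finₚ.≟ j
    ... | yes refl = subst (_∈ A) (sym (insertAt-lookup a i b)) (B⊆A b∈)
    ... | no i≢j = subst (λ l → insertAt a i b l ∈ A) (Finₚ.punchIn-punchOut i≢j)
            (subst (_∈ A) (sym (insertAt-punchIn a i b _)) (a∈ _))

  dil⊆mixed : ∀ {A B} → (∀ {b} → b ∈ B → b ∈ A) → ∀ {u} → u ∈ dil λs B → u ∈ mixed λs i B A
  dil⊆mixed {A} {B} B⊆A u∈ with ∈-dil⁻ λs u∈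
  ... | b , b∈ , refl = subst (_∈ mixed λs i B A) (sym (comb-remove λs b i))
    (∈-mixed⁺ (b∈ i) (∈-dil⁺ (removeAt λs i) (removeAt b i) (λ j → B⊆A (b∈ (punchIn i j)))))

  mixed-mono : ∀ {A B B′} → (∀ {b} → b ∈ B → b ∈ B′) → ∀ {u} → u ∈ mixed λs i B A → u ∈ mixed λs i B′ A
  mixed-mono B⊆ u∈ with ∈-mixed⁻ u∈
  ... | b , s , b∈ , s∈ , refl = ∈-mixed⁺ (B⊆ b∈) s∈

-- Lists, extremal elements, finite sums and products

length-filter-split : ∀ {B : Set} {P : B → Set} (P? : Decidable P) xs →
  length xs ≡ length (filter P? xs) ℕ.+ length (filter (¬? ∘ P?) xs)
length-filter-split P? [] = refl
length-filter-split P? (x ∷ xs) with P? x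
... | yes _ = cong suc (length-filter-split P? xs)
... | no _ = trans (cong suc (length-filter-split P? xs)) (sym (ℕₚ.+-suc _ _))

length-cartesianProduct : ∀ {B C : Set} (xs : List B) (ys : List C) →
  length (cartesianProduct xs ys) ≡ length xs ℕ.* length ys
length-cartesianProduct [] ys = refl
length-cartesianProduct (x ∷ xs) ys = trans (Listₚ.length-++ (map (x ,_) ys))
  (cong₂ ℕ._+_ (Listₚ.length-map (x ,_) ys) (length-cartesianProduct xs ys))

select : {P : Set} → Dec P → ℤ → ℤ → ℤ
select (yes _) x y = x
select (no _) x y = y

select-yes : ∀ {P : Set} {x y} (P? : Dec P) → P → select P? x y ≡ x
select-yes (yes _) p = refl
select-yes (no ¬p) p = contradiction p ¬p

select-no : ∀ {P : Set} {x y} (P? : Dec P) → ¬ P → select P? x y ≡ y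
select-no (yes p) ¬p = contradiction p ¬p
select-no (no _) ¬p = refl

least : ∀ {x xs} → x ∈ xs → ∃ λ m → m ∈ xs × (∀ {y} → y ∈ xs → m ℤ.≤ y)
least {xs = x ∷ []} _ = x , here refl , λ { (here refl) → ℤₚ.≤-refl }
least {xs = x ∷ xs@(_ ∷ _)} _ with least {xs = xs} (here refl)
... | m , m∈ , min with ℤₚ.≤-total m x
...   | inj₁ m≤x = m , there m∈ , λ { (here refl) → m≤x ; (there p) → min p }
...   | inj₂ x≤m = x , here refl , λ { (here refl) → ℤₚ.≤-refl ; (there p) → ℤₚ.≤-trans x≤m (min p) }

greatest : ∀ {x xs} → x ∈ xs → ∃ λ m → m ∈ xs × (∀ {y} → y ∈ xs → y ℤ.≤ m)
greatest {xs = x ∷ []} _ = x , here refl , λ { (here refl) → ℤₚ.≤-refl }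
greatest {xs = x ∷ xs@(_ ∷ _)} _ with greatest {xs = xs} (here refl)
... | m , m∈ , max with ℤₚ.≤-total x m
...   | inj₁ x≤m = m , there m∈ , λ { (here refl) → x≤m ; (there p) → max p }
...   | inj₂ m≤x = x , here refl , λ { (here refl) → ℤₚ.≤-refl ; (there p) → ℤₚ.≤-trans (max p) m≤x }

sum-mono : ∀ {k} {s t : Vector ℤ k} → (∀ i → s i ℤ.≤ t i) → sum s ℤ.≤ sum t
sum-mono {zero} h = ℤₚ.≤-refl
sum-mono {suc k} h = ℤₚ.+-mono-≤ (h zero) (sum-mono (h ∘ suc))

Σℕ-mono : ∀ {k} {s t : Vector ℕ k} → (∀ i → s i ℕ.≤ t i) → Σℕ.sum s ℕ.≤ Σℕ.sum t
Σℕ-mono {zero} h = ℕ.z≤n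
Σℕ-mono {suc k} h = ℕₚ.+-mono-≤ (h zero) (Σℕ-mono (h ∘ suc))

telescope : ∀ n (g : Vector ℕ n) (N : ℕ → ℕ) s → (∀ i → g i ℕ.+ N (suc (toℕ i)) ℕ.≤ s ℕ.+ N (toℕ i)) →
  Σℕ.sum g ℕ.+ N n ℕ.≤ n ℕ.* s ℕ.+ N 0
telescope zero g N s h = ℕₚ.≤-refl
telescope (suc n) g N s h = begin
  (g zero ℕ.+ rest) ℕ.+ N (suc n)    ≡⟨ ℕₚ.+-assoc (g zero) rest (N (suc n)) ⟩
  g zero ℕ.+ (rest ℕ.+ N (suc n))    ≤⟨ ℕₚ.+-monoʳ-≤ (g zero) (telescope n (g ∘ suc) (N ∘ suc) s (h ∘ suc)) ⟩
  g zero ℕ.+ (n ℕ.* s ℕ.+ N 1)       ≡⟨ swap (g zero) (n ℕ.* s) (N 1) ⟩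
  n ℕ.* s ℕ.+ (g zero ℕ.+ N 1)       ≤⟨ ℕₚ.+-monoʳ-≤ (n ℕ.* s) (h zero) ⟩
  n ℕ.* s ℕ.+ (s ℕ.+ N 0)            ≡⟨ swap′ (n ℕ.* s) s (N 0) ⟩
  suc n ℕ.* s ℕ.+ N 0                ∎
  where
  open ℕₚ.≤-Reasoning
  rest = Σℕ.sum (g ∘ suc)
  swap : ∀ a b c → a ℕ.+ (b ℕ.+ c) ≡ b ℕ.+ (a ℕ.+ c)
  swap = ℕsolve-∀
  swap′ : ∀ a b c → a ℕ.+ (b ℕ.+ c) ≡ (b ℕ.+ a) ℕ.+ c
  swap′ = ℕsolve-∀

prodᶠ : ∀ {k} → Vector ℕ k → ℕ
prodᶠ {zero} d = 1
prodᶠ {suc k} d = d zero ℕ.* prodᶠ (d ∘ suc)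

∣-prodᶠ : ∀ {k} (d : Vector ℕ k) i → + d i ∣ + prodᶠ d
∣-prodᶠ d zero = ∣ᵤ⇒∣ (ℕ∣.m∣m*n (prodᶠ (d ∘ suc)))
∣-prodᶠ d (suc i) = ∣-trans (∣-prodᶠ (d ∘ suc) i) (∣ᵤ⇒∣ (ℕ∣.n∣m*n (d zero)))

prodᶠ-nonZero : ∀ {k} (d : Vector ℕ k) → (∀ i → ℕ.NonZero (d i)) → ℕ.NonZero (prodᶠ d)
prodᶠ-nonZero {zero} d nz = _
prodᶠ-nonZero {suc k} d nz = ℕₚ.m*n≢0 (d zero) _ {{nz zero}} {{prodᶠ-nonZero (d ∘ suc) (nz ∘ suc)}}

punchIn-surjective : ∀ {k} {i j : Fin (suc k)} → i ≢ j → ∃ λ l → punchIn i l ≡ j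
punchIn-surjective i≢j = _ , Finₚ.punchIn-punchOut i≢j

-- Consequences of coprimality, and superadditivity

module Coprime {k} (λs : Vector ℤ (suc k)) (coprime : gcdᶠ λs ≡ 1) where

  d : Fin (suc k) → ℕ
  d i = gcdᶠ (removeAt λs i)

  d∣ : ∀ {i j} → i ≢ j → + d i ∣ λs j
  d∣ {i} i≢j with punchIn-surjective i≢j
  ... | l , refl = gcdᶠ-∣ (removeAt λs i) l

  1-closed : ∀ {P} → IsSubgroup P → (∀ i → P (λs i)) → P (+ 1)
  1-closed {P} G h = subst (λ g → P (+ g)) coprime (gcdᶠ-closed G λs h)

  -- Since `d i` divides every other coefficient, the hypothesis makes it divide `λs j * y` for all
  -- `j`, and then coprimality replaces `λs j` by 1.
  d∣-cancel : ∀ i y → + d i ∣ λs i * y → + d i ∣ y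
  d∣-cancel i y p = subst (+ d i ∣_) (ℤₚ.*-identityˡ y) (1-closed (∣*-subgroup (+ d i) y) member)
    where
    member : ∀ j → + d i ∣ λs j * y
    member j with i Finₚ.≟ j
    ... | yes refl = p
    ... | no i≢j = ∣m⇒∣m*n y (d∣ i≢j)

  -- 1 is an integer combination of the coefficients, and mod `d i` only the term with `λs i`
  -- survives.
  λ-invertible : ∀ i → ∃ λ x → + d i ∣ + 1 - λs i * x
  λ-invertible i = 1-closed {λ z → ∃ λ x → + d i ∣ z - λs i * x} G member
    where
    zer : ∀ l → + 0 ≡ + 0 - l * + 0
    zer = solve-∀
    add : ∀ a b l x y → (a - l * x) + (b - l * y) ≡ (a + b) - l * (x + y)
    add = solve-∀
    opp : ∀ a l x → - (a - l * x) ≡ - a - l * (- x)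
    opp = solve-∀
    one : ∀ l → + 0 ≡ l - l * + 1
    one = solve-∀
    nil : ∀ m l → m ≡ m - l * + 0
    nil = solve-∀
    G : IsSubgroup (λ z → ∃ λ x → + d i ∣ z - λs i * x)
    G = record
      { 0-closed = + 0 , subst (+ d i ∣_) (zer (λs i)) (divides (+ 0) refl)
      ; +-closed = λ { {a} {b} (x , p) (y , q) → x + y , subst (+ d i ∣_) (add a b (λs i) x y) (∣m∣n⇒∣m+n p q) }
      ; neg-closed = λ { {a} (x , p) → - x , subst (+ d i ∣_) (opp a (λs i) x) (∣m⇒∣-m p) } }
    member : ∀ j → ∃ λ x → + d i ∣ λs j - λs i * x
    member j with i Finₚ.≟ j
    ... | yes refl = + 1 , subst (+ d i ∣_) (one (λs i)) (divides (+ 0) refl)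
    ... | no i≢j = + 0 , subst (+ d i ∣_) (nil (λs j) (λs i)) (d∣ i≢j)

  ∣-dil : ∀ i {A s} → s ∈ dil (removeAt λs i) A → + d i ∣ s
  ∣-dil i s∈ with ∈-dil⁻ (removeAt λs i) s∈
  ... | a , _ , refl = ∣-comb (removeAt λs i) a (gcdᶠ-∣ (removeAt λs i))

  -- Class by class superadditivity of sumset cardinalities (Gyarmati, Matolcsi, Ruzsa): u ∈ S is compared with
  -- θ n u, the sum of the largest possible first n summands and the least possible other ones in the class of u.
  module Superadditivity (nz : ∀ i → ℕ.NonZero (d i)) (A : List ℤ) (hits : ∀ i → HitsAll (d i) A) where

    S : List ℤ
    S = dil λs A

    residue : Fin (suc k) → ℤ → ℕ
    residue j u = _%ℕ_ u (d j) {{nz j}}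

    -- In u = Σ λⱼaⱼ all terms but the j-th are divisible by `d j`, so the j-th is congruent to u.
    -- Which j-th summands are admissible for u thus depends only on the residue of u, and so do
    -- their extremes `lo` and `hi`.
    summands : Fin (suc k) → ℕ → List ℤ
    summands j r = filter (λ v → + d j ∣? + r - v) (λs j · A)

    summand : ∀ j r → ∃ λ v → v ∈ summands j r
    summand j r with λ-invertible j
    ... | x , p with hits j (+ r * x)
    ...   | a , a∈ , q = λs j * a , ∈-filter⁺ _ (∈-map⁺ (λ a → λs j * a) a∈)
      (subst (+ d j ∣_) (ident (+ r) (λs j) x a) (∣m∣n⇒∣m+n (∣n⇒∣m*n (+ r) p) (∣n⇒∣m*n (λs j) q)))
      where ident : ∀ r l x a → r * (+ 1 - l * x) + l * (r * x - a) ≡ r - l * a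
            ident = solve-∀

    summands⁻ : ∀ j u {v} → v ∈ summands j (residue j u) → (∃ λ a → a ∈ A × v ≡ λs j * a) × + d j ∣ u - v
    summands⁻ j u {v} v∈ with ∈-filter⁻ (λ v → + d j ∣? + residue j u - v) {xs = λs j · A} v∈
    ... | v∈′ , p = ∈-map⁻ _ v∈′ , ∣-chain u _ v (∣-residue (d j) {{nz j}} u) p

    summands⁺ : ∀ j u {a} → a ∈ A → + d j ∣ u - λs j * a → λs j * a ∈ summands j (residue j u)
    summands⁺ j u a∈ p = ∈-filter⁺ _ (∈-map⁺ (λ a → λs j * a) a∈)
      (∣-chain (+ residue j u) u _ (∣-sym u _ (∣-residue (d j) {{nz j}} u)) p)

    abstract
      lo hi : Fin (suc k) → ℤ → ℤ
      lo j u = proj₁ (least (proj₂ (summand j (residue j u))))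
      hi j u = proj₁ (greatest (proj₂ (summand j (residue j u))))

      lo-summand : ∀ j u → (∃ λ a → a ∈ A × lo j u ≡ λs j * a) × + d j ∣ u - lo j u
      lo-summand j u = summands⁻ j u (proj₁ (proj₂ (least (proj₂ (summand j (residue j u))))))

      hi-summand : ∀ j u → (∃ λ a → a ∈ A × hi j u ≡ λs j * a) × + d j ∣ u - hi j u
      hi-summand j u = summands⁻ j u (proj₁ (proj₂ (greatest (proj₂ (summand j (residue j u))))))

      lo-≤ : ∀ j u {a} → a ∈ A → + d j ∣ u - λs j * a → lo j u ℤ.≤ λs j * a
      lo-≤ j u a∈ p = proj₂ (proj₂ (least (proj₂ (summand j (residue j u))))) (summands⁺ j u a∈ p)

      hi-≥ : ∀ j u {a} → a ∈ A → + d j ∣ u - λs j * a → λs j * a ℤ.≤ hi j u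
      hi-≥ j u a∈ p = proj₂ (proj₂ (greatest (proj₂ (summand j (residue j u))))) (summands⁺ j u a∈ p)

      lo-cong : ∀ j u v → + d j ∣ u - v → lo j u ≡ lo j v
      lo-cong j u v p = cong (λ r → proj₁ (least (proj₂ (summand j r)))) (%ℕ-cong (d j) {{nz j}} u v p)

      hi-cong : ∀ j u v → + d j ∣ u - v → hi j u ≡ hi j v
      hi-cong j u v p = cong (λ r → proj₁ (greatest (proj₂ (summand j r)))) (%ℕ-cong (d j) {{nz j}} u v p)

    pick : ℕ → ℤ → Fin (suc k) → ℤ
    pick n u j = select (n ℕ.≤? toℕ j) (lo j u) (hi j u)

    pick-lo : ∀ n u j → n ℕ.≤ toℕ j → pick n u j ≡ lo j u
    pick-lo n u j = select-yes (n ℕ.≤? toℕ j)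

    pick-hi : ∀ n u j → toℕ j ℕ.< n → pick n u j ≡ hi j u
    pick-hi n u j j<n = select-no (n ℕ.≤? toℕ j) (ℕₚ.<⇒≱ j<n)

    -- A coordinate other than `i` lies on the same side of the thresholds `toℕ i` and
    -- `suc (toℕ i)`.
    pick-suc : ∀ i u v j → i ≢ j → + d j ∣ u - v → pick (suc (toℕ i)) u j ≡ pick (toℕ i) v j
    pick-suc i u v j i≢j p with ℕₚ.<-cmp (toℕ i) (toℕ j)
    ... | tri< i<j _ _ = trans (pick-lo (suc (toℕ i)) u j i<j) (trans (lo-cong j u v p) (sym (pick-lo (toℕ i) v j (ℕₚ.<⇒≤ i<j))))

    ... | tri≈ _ e _ = contradiction (Finₚ.toℕ-injective e) i≢j
    ... | tri> _ _ j<i = trans (pick-hi (suc (toℕ i)) u j (ℕₚ.m<n⇒m<1+n j<i)) (trans (hi-cong j u v p) (sym (pick-hi (toℕ i) v j j<i)))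

    θ : ℕ → ℤ → ℤ
    θ n u = sum (pick n u)

    lower? : ∀ n u → Dec (u ℤ.≤ θ n u)
    lower? n u = u ℤ.≤? θ n u

    upper? : ∀ n u → Dec (θ n u ℤ.< u)
    upper? n u = θ n u ℤ.<? u

    -- `lower n` passes from at most `D` elements at n = 0 to all of `S` at n = k + 1. By `step`,
    -- dᵢ|Sᵢ| is at most |S| minus the increase from n = i to n = i + 1, so the sum telescopes.
    lower upper : ℕ → List ℤ
    lower n = filter (lower? n) S
    upper n = filter (upper? n) S

    lower⁻ : ∀ n {u} → u ∈ lower n → u ∈ S × u ℤ.≤ θ n u
    lower⁻ n = ∈-filter⁻ (lower? n) {xs = S}

    upper⁻ : ∀ n {u} → u ∈ upper n → u ∈ S × θ n u ℤ.< u
    upper⁻ n = ∈-filter⁻ (upper? n) {xs = S}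

    lower+upper : ∀ n → card (lower n) ℕ.+ card (upper n) ℕ.≤ card S
    lower+upper n = card-disjoint {lower n} {upper n} {S} (λ p → proj₁ (lower⁻ n p)) (λ p → proj₁ (upper⁻ n p))
      λ p q → ℤₚ.<⇒≱ (proj₂ (upper⁻ n q)) (proj₂ (lower⁻ n p))

    module _ (i : Fin (suc k)) where

      Sᵢ : List ℤ
      Sᵢ = dil (removeAt λs i) A

      -- Each pair contributes one element: its `top` to `upper` at i + 1, or else its `bottom` to
      -- `lower` at i.
      pairs : List (ℤ × ℕ)
      pairs = cartesianProduct (deduplicate ℤ._≟_ Sᵢ) (upTo (d i))

      pairs⁻ : ∀ {s t} → (s , t) ∈ pairs → s ∈ Sᵢ × t ℕ.< d i
      pairs⁻ p = let s∈ , t∈ = ∈-cartesianProduct⁻ (deduplicate ℤ._≟_ Sᵢ) (upTo (d i)) p in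
        ∈-deduplicate⁻ ℤ._≟_ Sᵢ s∈ , ∈-upTo⁻ t∈

      top bottom : ℤ × ℕ → ℤ
      top p = proj₁ p + hi i (+ proj₂ p)
      bottom p = proj₁ p + lo i (+ proj₂ p)

      -- Elements of `Sᵢ` vanish mod `d i` and `f t` is congruent to `t`, so the sum reveals first
      -- `t` and then `s`.
      shift-injective : (f : ℤ → ℤ) → (∀ t → + d i ∣ t - f t) → InjectiveOn (λ p → proj₁ p + f (+ proj₂ p)) pairs
      shift-injective f h {s , t} {s′ , t′} p p′ e = cong₂ _,_ s≡s′ t≡t′
        where
        rearrange : ∀ t t′ x x′ s s′ → ((t - x) - (t′ - x′)) + (s′ - s) ≡ (t - t′) + ((s′ + x′) - (s + x))
        rearrange = solve-∀
        cancel : ∀ a b → a + (b - b) ≡ a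
        cancel = solve-∀
        ident : ((+ t - f (+ t)) - (+ t′ - f (+ t′))) + (s′ - s) ≡ + t - + t′
        ident = trans (rearrange (+ t) (+ t′) (f (+ t)) (f (+ t′)) s s′)
          (trans (cong (λ z → (+ t - + t′) + (z - (s + f (+ t)))) (sym e)) (cancel (+ t - + t′) (s + f (+ t))))
        t≡t′ : t ≡ t′
        t≡t′ = residue-unique (proj₂ (pairs⁻ p)) (proj₂ (pairs⁻ p′)) (subst (+ d i ∣_) ident
          (∣m∣n⇒∣m+n (∣m∣n⇒∣m-n (h (+ t)) (h (+ t′))) (∣m∣n⇒∣m-n (∣-dil i (proj₁ (pairs⁻ p′))) (∣-dil i (proj₁ (pairs⁻ p))))))
        s≡s′ : s ≡ s′
        s≡s′ = ∙-cancelʳ (f (+ t)) s s′ (trans e (cong (λ r → s′ + f (+ r)) (sym t≡t′)))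

      shift∈S : ∀ {s t} {f : ℤ → ℤ} → (∃ λ a → a ∈ A × f t ≡ λs i * a) → s ∈ Sᵢ → s + f t ∈ S
      shift∈S {s} (a , a∈ , e) s∈ = subst (_∈ S) (trans (ℤₚ.+-comm _ s) (cong (λ z → s + z) (sym e)))
        (mixed⊆dil λs i {A} {A} id (∈-mixed⁺ λs i {A} {A} a∈ s∈))

      isTop? : (p : ℤ × ℕ) → Dec (θ (suc (toℕ i)) (top p) ℤ.< top p)
      isTop? p = θ (suc (toℕ i)) (top p) ℤ.<? top p

      -- `top` and `bottom` differ by a multiple of `λs i`, which `d j` divides for every other `j`.
      -- So the picks agree outside coordinate `i`, where they are `hi i (+ t)` and `lo i (+ t)`.
      θ-step : ∀ {s t} → s ∈ Sᵢ →
        θ (suc (toℕ i)) (top (s , t)) - hi i (+ t) ≡ θ (toℕ i) (bottom (s , t)) - lo i (+ t)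
      θ-step {s} {t} s∈ = trans (cong (_- hi i (+ t)) (sum-remove {i = i} (pick (suc (toℕ i)) u)))
        (trans (cong₂ (λ x y → (x + y) - hi i (+ t)) at-top rest)
        (trans (cancel (hi i (+ t)) (lo i (+ t)) _)
        (trans (cong (λ x → (x + sum (removeAt (pick (toℕ i) v) i)) - lo i (+ t)) (sym at-bottom))
               (cong (_- lo i (+ t)) (sym (sum-remove {i = i} (pick (toℕ i) v)))))))
        where
        u = top (s , t)
        v = bottom (s , t)
        cancel : ∀ h l x → (h + x) - h ≡ (l + x) - l
        cancel = solve-∀
        shifted : ∀ {x} → + d i ∣ + t - x → + d i ∣ (s + x) - + t
        shifted {x} p = subst (+ d i ∣_) (ident s (+ t) x) (∣m∣n⇒∣m-n (∣-dil i s∈) p)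
          where ident : ∀ s t x → s - (t - x) ≡ (s + x) - t
                ident = solve-∀
        at-top : pick (suc (toℕ i)) u i ≡ hi i (+ t)
        at-top = trans (pick-hi (suc (toℕ i)) u i ℕₚ.≤-refl) (hi-cong i u (+ t) (shifted (proj₂ (hi-summand i (+ t)))))
        at-bottom : pick (toℕ i) v i ≡ lo i (+ t)
        at-bottom = trans (pick-lo (toℕ i) v i ℕₚ.≤-refl) (lo-cong i v (+ t) (shifted (proj₂ (lo-summand i (+ t)))))
        close : ∀ j → i ≢ j → + d j ∣ u - v
        close j i≢j with lo-summand i (+ t) | hi-summand i (+ t)
        ... | (a , _ , ea) , _ | (b , _ , eb) , _ = subst (+ d j ∣_)
          (trans (ident s (λs i) a b) (cong₂ (λ x y → (s + x) - (s + y)) (sym eb) (sym ea))) (∣m⇒∣m*n (b - a) (d∣ (i≢j ∘ sym)))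
          where ident : ∀ s l a b → l * (b - a) ≡ (s + l * b) - (s + l * a)
                ident = solve-∀
        rest : sum (removeAt (pick (suc (toℕ i)) u) i) ≡ sum (removeAt (pick (toℕ i) v) i)
        rest = sum-cong-≗ λ l → let i≢j = Finₚ.punchInᵢ≢i i l ∘ sym in pick-suc i u v (punchIn i l) i≢j (close _ i≢j)

      length-pairs : length pairs ≡ card Sᵢ ℕ.* d i
      length-pairs = trans (length-cartesianProduct (deduplicate ℤ._≟_ Sᵢ) (upTo (d i)))
        (cong (card Sᵢ ℕ.*_) (Listₚ.length-upTo (d i)))

      pairs-unique : Unique pairs
      pairs-unique = cartesianProduct⁺ (deduplicate-! Sᵢ) (upTo⁺ (d i))

      tops≤ : length (filter isTop? pairs) ℕ.≤ card (upper (suc (toℕ i)))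
      tops≤ = length≤card top (unique-filter⁺ isTop? pairs-unique)
        (λ p q → shift-injective (hi i) (λ t → proj₂ (hi-summand i t)) (proj₁ (∈-filter⁻ isTop? p)) (proj₁ (∈-filter⁻ isTop? q)))
        λ { {s , t} p → let p∈ , above = ∈-filter⁻ isTop? {xs = pairs} p in
          ∈-filter⁺ (upper? (suc (toℕ i))) (shift∈S {f = hi i} (proj₁ (hi-summand i (+ t))) (proj₁ (pairs⁻ p∈))) above }

      bottoms≤ : length (filter (¬? ∘ isTop?) pairs) ℕ.≤ card (lower (toℕ i))
      bottoms≤ = length≤card bottom (unique-filter⁺ (¬? ∘ isTop?) pairs-unique)
        (λ p q → shift-injective (lo i) (λ t → proj₂ (lo-summand i t)) (proj₁ (∈-filter⁻ (¬? ∘ isTop?) p)) (proj₁ (∈-filter⁻ (¬? ∘ isTop?) q)))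
        λ { {s , t} p → let p∈ , ¬above = ∈-filter⁻ (¬? ∘ isTop?) {xs = pairs} p
                            s∈ = proj₁ (pairs⁻ p∈) in
          ∈-filter⁺ (lower? (toℕ i)) (shift∈S {f = lo i} (proj₁ (lo-summand i (+ t))) s∈) (below s∈ ¬above) }
        where
        cancel : ∀ s x → (s + x) - x ≡ s
        cancel = solve-∀
        cancel′ : ∀ s x → (s - x) + x ≡ s
        cancel′ = solve-∀
        -- By `θ-step`, comparing `top` with `θ (suc (toℕ i))` and `bottom` with `θ (toℕ i)` amounts
        -- to comparing `s` with one and the same number.
        below : ∀ {s t} → s ∈ Sᵢ → ¬ (θ (suc (toℕ i)) (top (s , t)) ℤ.< top (s , t)) → bottom (s , t) ℤ.≤ θ (toℕ i) (bottom (s , t))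
        below {s} {t} s∈ ¬above = subst (s + lo i (+ t) ℤ.≤_) (trans (cong (_+ lo i (+ t)) (θ-step s∈)) (cancel′ _ (lo i (+ t))))
          (ℤₚ.+-monoˡ-≤ (lo i (+ t)) (subst (ℤ._≤ θ (suc (toℕ i)) (top (s , t)) - hi i (+ t)) (cancel s (hi i (+ t)))
            (ℤₚ.+-monoˡ-≤ (- hi i (+ t)) (ℤₚ.≮⇒≥ ¬above))))

      step : d i ℕ.* card Sᵢ ℕ.+ card (lower (suc (toℕ i))) ℕ.≤ card S ℕ.+ card (lower (toℕ i))
      step = begin
        d i ℕ.* card Sᵢ ℕ.+ L′          ≡⟨ cong (ℕ._+ L′)
          (trans (ℕₚ.*-comm (d i) (card Sᵢ)) (trans (sym length-pairs) (length-filter-split isTop? pairs))) ⟩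
        (length (filter isTop? pairs) ℕ.+ length (filter (¬? ∘ isTop?) pairs)) ℕ.+ L′
                                         ≤⟨ ℕₚ.+-monoˡ-≤ L′ (ℕₚ.+-mono-≤ tops≤ bottoms≤) ⟩
        (U′ ℕ.+ L) ℕ.+ L′               ≡⟨ rearrange U′ L L′ ⟩
        (L′ ℕ.+ U′) ℕ.+ L               ≤⟨ ℕₚ.+-monoˡ-≤ L (lower+upper (suc (toℕ i))) ⟩
        card S ℕ.+ L                     ∎
        where
        open ℕₚ.≤-Reasoning
        L′ = card (lower (suc (toℕ i)))
        U′ = card (upper (suc (toℕ i)))
        L = card (lower (toℕ i))
        rearrange : ∀ a b c → (a ℕ.+ b) ℕ.+ c ≡ (c ℕ.+ a) ℕ.+ b
        rearrange = ℕsolve-∀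

    u-coordinate : ∀ a j → + d j ∣ comb λs a - λs j * a j
    u-coordinate a j = ∣-comb-coordinate λs a j (gcdᶠ-∣ (removeAt λs j))

    card≤lower : card S ℕ.≤ card (lower (suc k))
    card≤lower = card-⊆ {S} {lower (suc k)} λ {u} u∈ → ∈-filter⁺ (lower? (suc k)) u∈ (bounded u∈)
      where
      bounded : ∀ {u} → u ∈ S → u ℤ.≤ θ (suc k) u
      bounded u∈ with ∈-dil⁻ λs u∈
      ... | a , a∈ , refl = sum-mono λ j → subst (λs j * a j ℤ.≤_) (sym (pick-hi (suc k) (comb λs a) j (Finₚ.toℕ<n j)))
              (hi-≥ j (comb λs a) (a∈ j) (u-coordinate a j))

    D : ℕ
    D = prodᶠ d

    -- No element of `S` is below the sum of its least summands, so those of `lower 0` equal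
    -- `θ 0 u`, which depends only on `u` mod `D`.
    lower₀≤ : card (lower 0) ℕ.≤ D
    lower₀≤ = subst (card (lower 0) ℕ.≤_) (length-residues D)
      (length-injectiveOn (λ u → + (_%ℕ_ u D {{D≢0}})) (deduplicate-! (lower 0))
        (λ {u} {v} p q e → trans (minimal p) (trans (sum-cong-≗ (same u v (ℤₚ.+-injective e))) (sym (minimal q))))
        (λ {u} _ → ∈-map⁺ +_ (∈-upTo⁺ (n%ℕd<d u D {{D≢0}}))))
      where
      D≢0 = prodᶠ-nonZero d nz
      minimal : ∀ {u} → u ∈ deduplicate ℤ._≟_ (lower 0) → u ≡ θ 0 u
      minimal p with lower⁻ 0 (∈-deduplicate⁻ ℤ._≟_ (lower 0) p)
      ... | u∈ , u≤ with ∈-dil⁻ λs u∈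
      ...   | a , a∈ , refl = ℤₚ.≤-antisym u≤ (sum-mono λ j → subst (ℤ._≤ λs j * a j) (sym (pick-lo 0 (comb λs a) j ℕ.z≤n))
                (lo-≤ j (comb λs a) (a∈ j) (u-coordinate a j)))
      same : ∀ u v → _%ℕ_ u D {{D≢0}} ≡ _%ℕ_ v D {{D≢0}} → ∀ j → pick 0 u j ≡ pick 0 v j
      same u v e j = trans (pick-lo 0 u j ℕ.z≤n) (trans (lo-cong j u v (∣-trans (∣-prodᶠ d j)
        (∣-chain u _ v (∣-residue D {{D≢0}} u) (subst (λ r → + D ∣ + r - v) (sym e) (∣-sym v _ (∣-residue D {{D≢0}} v))))))
        (sym (pick-lo 0 v j ℕ.z≤n)))

    superadditivity : Σℕ.sum (λ i → d i ℕ.* card (dil (removeAt λs i) A)) ℕ.≤ k ℕ.* card S ℕ.+ D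
    superadditivity = ℕₚ.+-cancelʳ-≤ (card S) _ _ (begin
      total ℕ.+ card S                    ≤⟨ ℕₚ.+-monoʳ-≤ total card≤lower ⟩
      total ℕ.+ card (lower (suc k))      ≤⟨ telescope (suc k) _ (card ∘ lower) (card S) step ⟩
      suc k ℕ.* card S ℕ.+ card (lower 0) ≤⟨ ℕₚ.+-monoʳ-≤ (suc k ℕ.* card S) lower₀≤ ⟩
      suc k ℕ.* card S ℕ.+ D              ≡⟨ rearrange (card S) (k ℕ.* card S) D ⟩
      (k ℕ.* card S ℕ.+ D) ℕ.+ card S     ∎)
      where
      open ℕₚ.≤-Reasoning
      total = Σℕ.sum (λ i → d i ℕ.* card (dil (removeAt λs i) A))
      rearrange : ∀ s t D → (s ℕ.+ t) ℕ.+ D ≡ (t ℕ.+ D) ℕ.+ s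
      rearrange = ℕsolve-∀

-- Leaving the residue classes of S(B) mod dᵢ²

-- The stabiliser of a set of residues mod `M`. Periodicity yields negatives, as -x is congruent to
-- (M - 1)x.
shift-subgroup : ∀ {Q : ℤ → Set} M .{{_ : ℕ.NonZero M}} → (∀ {m n} → + M ∣ m - n → Q m → Q n) →
  IsSubgroup (λ g → ∀ n → Q n → Q (n + g))
shift-subgroup {Q} M@(suc M′) periodic = record
  { 0-closed = λ n q → subst Q (sym (ℤₚ.+-identityʳ n)) q
  ; +-closed = λ {x} {y} p q n h → subst Q (ℤₚ.+-assoc n x y) (q (n + x) (p n h))
  ; neg-closed = λ {x} p n h → periodic (divides x (ident n x (+ M′))) (iterate p M′ n h) }
  where
  ident : ∀ n x m → (n + m * x) - (n + - x) ≡ x * (+ 1 + m)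
  ident = solve-∀
  iterate : ∀ {x} → (∀ n → Q n → Q (n + x)) → ∀ j n → Q n → Q (n + + j * x)
  iterate {x} p zero n h = subst Q (sym (ℤₚ.+-identityʳ n)) h
  iterate {x} p (suc j) n h = subst Q (trans (ℤₚ.+-assoc n x (+ j * x)) (cong (λ z → n + z) (sym (ℤₚ.suc-* (+ j) x))))
    (iterate p j (n + x) (p n h))

preimage-subgroup : ∀ {P} m → IsSubgroup P → IsSubgroup (λ x → P (m * x))
preimage-subgroup {P} m G = record
  { 0-closed = subst P (sym (ℤₚ.*-zeroʳ m)) 0-closed
  ; +-closed = λ {x} {y} p q → subst P (sym (ℤₚ.*-distribˡ-+ m x y)) (+-closed p q)
  ; neg-closed = λ {x} p → subst P (ℤₚ.neg-distribʳ-* m x) (neg-closed p) }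
  where open IsSubgroup G

comb-update : ∀ {k} (λs a : Vector ℤ k) l x → comb λs (updateAt a l (λ _ → x)) ≡ comb λs a + λs l * (x - a l)
comb-update λs a zero x = ident (λs zero) x (a zero) _
  where ident : ∀ l x a s → l * x + s ≡ (l * a + s) + l * (x - a)
        ident = solve-∀
comb-update λs a (suc l) x = trans (cong (λ z → λs zero * a zero + z) (comb-update (λs ∘ suc) (a ∘ suc) l x))
  (sym (ℤₚ.+-assoc (λs zero * a zero) _ _))

module Exit {k} (λs : Vector ℤ (suc k)) (coprime : gcdᶠ λs ≡ 1) (i : Fin (suc k))
  (dᵢ≢0 : ℕ.NonZero (gcdᶠ (removeAt λs i))) (A : List ℤ) (gen : Generates A) (r : ℤ) where

  open Coprime λs coprime

  μs : Vector ℤ k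
  μs = removeAt λs i

  W : List ℤ
  W = dil μs A

  M : ℕ
  M = d i ℕ.* d i

  affine : ℤ → ℤ
  affine x = r + + d i * x

  -- The part of `λs i * affine x` that depends on `x`; the common shift `λs i * r` is left out.
  class-of : ℤ → ℤ
  class-of x = λs i * (+ d i * x)

  module _ {X x₀} (x₀∈ : x₀ ∈ X) (X⊆ : ∀ {x} → x ∈ X → affine x ∈ A) where

    w₀ : ℤ
    w₀ = comb μs (λ _ → affine x₀)

    -- Let B be the image of `X` under `affine`. The other coefficients and the differences within B
    -- are all divisible by dᵢ, so mod dᵢ² the other summands of an element of S(B) always add up to
    -- `w₀`. Hence a leaving pair puts `λs i * affine x + w` outside S(B).
    Leaves : ℤ → ℤ → Set
    Leaves x w = ¬ Any.Any (λ x′ → + M ∣ (class-of x + w) - (class-of x′ + w₀)) X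

    leaves? : ∀ x w → Dec (Leaves x w)
    leaves? x w = ¬? (Any.any? (λ x′ → + M ∣? (class-of x + w) - (class-of x′ + w₀)) X)

    -- If no element leaves, the classes of λᵢ·dX mod d² are stable under all differences of W, hence under d.
    stays⇒hitsAll : (∀ {x w} → x ∈ X → w ∈ W → ¬ Leaves x w) → HitsAll (d i) X
    stays⇒hitsAll stays y = let x′ , x′∈ , p = reach in x′ , x′∈ ,
      d∣-cancel i (y - x′) (*-cancelˡ-∣ (+ d i) {{dᵢ≢0}} (subst (+ d i * + d i ∣_) (factor (λs i) (+ d i) x₀ y x′)
        (subst (_∣ (class-of x₀ + λs i * (y - x₀) * + d i) - class-of x′) (ℤₚ.pos-* (d i) (d i)) p)))
      where
      factor : ∀ l e x₀ y x′ → (l * (e * x₀) + l * (y - x₀) * e) - l * (e * x′) ≡ e * (l * (y - x′))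
      factor = solve-∀
      Q : ℤ → Set
      Q n = ∃ λ x → x ∈ X × + M ∣ n - class-of x
      Γ : ℤ → Set
      Γ g = ∀ n → Q n → Q (n + g)
      G : IsSubgroup Γ
      G = shift-subgroup M {{ℕₚ.m*n≢0 (d i) (d i) {{dᵢ≢0}} {{dᵢ≢0}}}}
        λ { {m} {n} p (x , x∈ , q) → x , x∈ , ∣-chain n m (class-of x) (∣-sym m n p) q }
      W-difference : ∀ {w} → w ∈ W → Γ (w - w₀)
      W-difference {w} w∈ n (x , x∈ , p)
        with find (decidable-stable (Any.any? (λ x′ → + M ∣? (class-of x + w) - (class-of x′ + w₀)) X) (stays x∈ w∈))
      ... | x′ , x′∈ , q = x′ , x′∈ , subst (+ M ∣_) (ident n (class-of x) (class-of x′) w w₀) (∣m∣n⇒∣m+n p q)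
        where ident : ∀ n c c′ w w₀ → (n - c) + ((c + w) - (c′ + w₀)) ≡ (n + (w - w₀)) - c′
              ident = solve-∀
      -- Changing one coordinate of the constant choice `affine x₀` isolates this product as a
      -- difference of elements of `W`.
      coordinate : ∀ l {a} → a ∈ A → Γ (μs l * (a - affine x₀))
      coordinate l {a} a∈ = subst Γ (trans (cong (_- w₀) (comb-update μs (λ _ → affine x₀) l a)) (cancel w₀ _))
        (W-difference (∈-dil⁺ μs (updateAt (λ _ → affine x₀) l (λ _ → a)) member))
        where
        cancel : ∀ w z → (w + z) - w ≡ z
        cancel = solve-∀
        member : ∀ j → updateAt (λ _ → affine x₀) l (λ _ → a) j ∈ A
        member j with j Finₚ.≟ l
        ... | yes refl = subst (_∈ A) (sym (updateAt-updates l (λ _ → affine x₀))) a∈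
        ... | no j≢l = subst (_∈ A) (sym (updateAt-minimal j l (λ _ → affine x₀) j≢l)) (X⊆ x₀∈)
      μs-closed : ∀ l → Γ (μs l)
      μs-closed l = subst Γ (ℤₚ.*-identityʳ (μs l)) (gen (preimage-subgroup (μs l) G)
        λ {a} {b} a∈ b∈ → subst Γ (ident (μs l) a b (affine x₀)) (IsSubgroup.sub-closed G (coordinate l a∈) (coordinate l b∈)))
        where ident : ∀ m a b c → m * (a - c) - m * (b - c) ≡ m * (a - b)
              ident = solve-∀
      -- Now dᵢ itself stabilises `Q`; the multiple is chosen to carry `class-of x₀` to
      -- `class-of y`.
      reach : Q (class-of x₀ + λs i * (y - x₀) * + d i)
      reach = IsSubgroup.*-closed G (λs i * (y - x₀)) (gcdᶠ-closed G μs μs-closed) (class-of x₀)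
        (x₀ , x₀∈ , subst (+ M ∣_) (sym (ℤₚ.+-inverseʳ (class-of x₀))) (divides (+ 0) refl))

    exit : Misses (d i) X → ∃ λ x → ∃ λ w → x ∈ X × w ∈ W × Leaves x w
    exit (m , miss) with Any.any? (λ x → Any.any? (leaves? x) W) X
    ... | yes p = let x , x∈ , q = find p ; w , w∈ , lv = find q in x , w , x∈ , w∈ , lv
    ... | no ¬p = let x′ , x′∈ , q = stays⇒hitsAll stays m in ⊥-elim (miss x′∈ q)
      where
      stays : ∀ {x w} → x ∈ X → w ∈ W → ¬ Leaves x w
      stays x∈ w∈ lv = ¬p (Any.map (λ { refl → Any.map (λ { refl → lv }) w∈ }) x∈)

    -- Moving `x` within its class mod dᵢ changes `affine x` by a multiple of dᵢ², so the whole
    -- class leaves with the same `w`.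
    gain : .{{_ : ℤ.NonZero (λs i)}} → ∀ {x w} → w ∈ W → Leaves x w →
      card (dil λs (map affine X)) ℕ.+ card (class (d i) x X) ℕ.≤ card (mixed λs i (map affine X) A)
    gain {x} {w} w∈ lv = ℕₚ.≤-trans
      (ℕₚ.+-monoʳ-≤ (card (dil λs (map affine X))) (card-injectiveOn {class (d i) x X} {new} shift shift-inj (∈-map⁺ shift)))
      (card-disjoint {dil λs (map affine X)} {new} {mixed λs i (map affine X) A} (dil⊆mixed λs i {A} {map affine X} B⊆) new⊆ disjoint)
      where
      shift : ℤ → ℤ
      shift y = λs i * affine y + w
      new = map shift (class (d i) x X)
      shift-inj : InjectiveOn shift (class (d i) x X)
      shift-inj {y} {z} _ _ e = ℤₚ.*-cancelˡ-≡ (+ d i) y z {{dᵢ≢0}}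
        (∙-cancelˡ r _ _ (ℤₚ.*-cancelˡ-≡ (λs i) (affine y) (affine z) (∙-cancelʳ w _ _ e)))
      class⁻ : ∀ {y} → y ∈ class (d i) x X → y ∈ X × + d i ∣ y - x
      class⁻ = ∈-filter⁻ (λ y → + d i ∣? y - x) {xs = X}
      B⊆ : ∀ {b} → b ∈ map affine X → b ∈ A
      B⊆ b∈ with ∈-map⁻ affine b∈
      ... | y , y∈ , refl = X⊆ y∈
      new⊆ : ∀ {u} → u ∈ new → u ∈ mixed λs i (map affine X) A
      new⊆ u∈ with ∈-map⁻ shift u∈
      ... | y , y∈ , refl = ∈-mixed⁺ λs i {A} {map affine X} (∈-map⁺ affine (proj₁ (class⁻ y∈))) w∈
      disjoint : ∀ {u} → u ∈ dil λs (map affine X) → u ∈ new → ⊥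
      disjoint u∈ u∈new with ∈-map⁻ shift u∈new | ∈-dil⁻ λs u∈
      ... | y , y∈ , refl | b , b∈ , e with ∈-map⁻ affine (b∈ i)
      ...   | x′ , x′∈ , eᵢ = lv (Any.map (λ { refl → conclude }) x′∈)
        where
        w′ = comb μs (removeAt b i)
        d²∣ : ∀ {z z′} → + d i ∣ z → + d i ∣ z′ → + M ∣ z * z′
        d²∣ (divides p refl) (divides q refl) = divides (p * q) (trans (ident p q (+ d i)) (cong (p * q *_) (sym (ℤₚ.pos-* (d i) (d i)))))
          where ident : ∀ p q e → (p * e) * (q * e) ≡ (p * q) * (e * e)
                ident = solve-∀
        close : ∀ l → + M ∣ μs l * (b (punchIn i l) - affine x₀)
        close l = d²∣ (gcdᶠ-∣ μs l) (near (∈-map⁻ affine (b∈ (punchIn i l))))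
          where
          near : (∃ λ z → z ∈ X × b (punchIn i l) ≡ affine z) → + d i ∣ b (punchIn i l) - affine x₀
          near (z , _ , ez) = divides (z - x₀) (trans (cong (_- affine x₀) ez) (ident r (+ d i) z x₀))
            where ident : ∀ r e z x → (r + e * z) - (r + e * x) ≡ (z - x) * e
                  ident = solve-∀
        w′≈w₀ : + M ∣ w′ - w₀
        w′≈w₀ = ∣-comb-difference μs (removeAt b i) (λ _ → affine x₀) close
        equation : (λs i * (+ d i * y) + w) - (λs i * (+ d i * x′) + w′) ≡ + 0
        equation = trans (ident (λs i) r (+ d i) y x′ w w′)
          (trans (cong (_- (λs i * affine x′ + w′)) (trans e (trans (comb-remove λs b i) (cong (λ z → λs i * z + w′) eᵢ))))
                 (ℤₚ.+-inverseʳ (λs i * affine x′ + w′)))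
          where ident : ∀ l r e y x w w′ → (l * (e * y) + w) - (l * (e * x) + w′) ≡ (l * (r + e * y) + w) - (l * (r + e * x) + w′)
                ident = solve-∀
        conclude : + M ∣ (class-of x + w) - (class-of x′ + w₀)
        conclude = subst (+ M ∣_) (ident (λs i) (+ d i) x y x′ w w′ w₀)
          (∣m∣n⇒∣m-n (∣m∣n⇒∣m+n (subst (+ M ∣_) (sym equation) (divides (+ 0) refl)) w′≈w₀)
            (∣n⇒∣m*n (λs i) (d²∣ ∣-refl (proj₂ (class⁻ y∈)))))
          where ident : ∀ l e x y x′ w w′ w₀ →
                  ((l * (e * y) + w) - (l * (e * x′) + w′) + (w′ - w₀)) - l * (e * (y - x)) ≡ (l * (e * x) + w) - (l * (e * x′) + w₀)
                ident = solve-∀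

-- Weights and the arithmetic of the improvement

weight : ∀ {k} → Vector ℤ k → ℕ
weight λs = Σℕ.sum (λ i → abs (λs i))

Σℕ-const : ∀ n c → Σℕ.sum {n} (λ _ → c) ≡ n ℕ.* c
Σℕ-const zero c = refl
Σℕ-const (suc n) c = cong (c ℕ.+_) (Σℕ-const n c)

≤-Σℕ : ∀ {n} (f : Vector ℕ n) i → f i ℕ.≤ Σℕ.sum f
≤-Σℕ f zero = ℕₚ.m≤m+n _ _
≤-Σℕ f (suc i) = ℕₚ.≤-trans (≤-Σℕ (f ∘ suc) i) (ℕₚ.m≤n+m _ _)

weight-remove : ∀ {k} (λs : Vector ℤ (suc k)) → Σℕ.sum (λ i → weight (removeAt λs i)) ≡ k ℕ.* weight λs
weight-remove {k} λs = ℕₚ.+-cancelˡ-≡ (weight λs) _ _ (begin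
  weight λs ℕ.+ Σℕ.sum (λ i → weight (removeAt λs i))    ≡⟨ sym (Σℕ.∑-distrib-+ (λ i → abs (λs i)) (λ i → weight (removeAt λs i))) ⟩
  Σℕ.sum (λ i → abs (λs i) ℕ.+ weight (removeAt λs i))   ≡⟨ Σℕ.sum-cong-≗ (λ i → sym (Σℕ.sum-remove {i = i} (λ j → abs (λs j)))) ⟩
  Σℕ.sum (λ (_ : Fin (suc k)) → weight λs)                ≡⟨ Σℕ-const (suc k) (weight λs) ⟩
  weight λs ℕ.+ k ℕ.* weight λs                           ∎)
  where
        open ≡-Reasoning

search : ∀ {n} {P Q : Fin n → Set} → (∀ i → P i ⊎ Q i) → (∀ i → P i) ⊎ ∃ Q
search {zero} h = inj₁ λ ()
search {suc n} h with h zero | search (h ∘ suc)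
... | inj₂ q | _ = inj₂ (zero , q)
... | inj₁ p | inj₂ (i , q) = inj₂ (suc i , q)
... | inj₁ p | inj₁ ps = inj₁ λ { zero → p ; (suc i) → ps i }

-- Arithmetic of the two cases of the recursion over residue classes: a class with at least a proportion
-- 1/Kⁿ of the elements is a sufficient gain, and a smaller one can be deleted.
large-class : ∀ {t e p E c w f T C} → e ℕ.* p ≡ E → c ℕ.≤ p ℕ.* w → f ℕ.+ w ℕ.≤ T → t ℕ.* c ℕ.≤ E ℕ.* f ℕ.+ C →
  (t ℕ.+ e) ℕ.* c ℕ.≤ E ℕ.* T ℕ.+ C
large-class {t} {e} {p} {E} {c} {w} {f} {T} {C} ep≡E c≤ gain hyp = begin
  (t ℕ.+ e) ℕ.* c                          ≡⟨ ℕₚ.*-distribʳ-+ c t e ⟩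
  t ℕ.* c ℕ.+ e ℕ.* c                      ≤⟨ ℕₚ.+-mono-≤ hyp (ℕₚ.*-monoʳ-≤ e c≤) ⟩
  (E ℕ.* f ℕ.+ C) ℕ.+ e ℕ.* (p ℕ.* w)      ≡⟨ cong ((E ℕ.* f ℕ.+ C) ℕ.+_) (trans (sym (ℕₚ.*-assoc e p w)) (cong (ℕ._* w) ep≡E)) ⟩
  (E ℕ.* f ℕ.+ C) ℕ.+ E ℕ.* w              ≡⟨ ident E f C w ⟩
  E ℕ.* (f ℕ.+ w) ℕ.+ C                    ≤⟨ ℕₚ.+-monoˡ-≤ C (ℕₚ.*-monoʳ-≤ E gain) ⟩
  E ℕ.* T ℕ.+ C                            ∎
  where
  open ℕₚ.≤-Reasoning
  ident : ∀ E f C w → (E ℕ.* f ℕ.+ C) ℕ.+ E ℕ.* w ≡ E ℕ.* (f ℕ.+ w) ℕ.+ C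
  ident = ℕsolve-∀

-- Deleting the class costs at most L·e·c from t·w and e·c from e·K·w, while raising e to e·K brings
-- (K - 1)·e·c. The choice K = L + 2 balances the two exactly.
small-class : ∀ {t e L p c w c′ B} (let K = suc (suc L)) → .{{_ : ℕ.NonZero p}} → t ℕ.≤ L ℕ.* (e ℕ.* (K ℕ.* p)) →
  (K ℕ.* p) ℕ.* w ℕ.≤ c → c ℕ.≤ w ℕ.+ c′ → (t ℕ.+ e ℕ.* K) ℕ.* c′ ℕ.≤ B → (t ℕ.+ e) ℕ.* c ℕ.≤ B
small-class {t} {e} {L} {p} {c} {w} {c′} {B} t≤ small cover ih = ℕₚ.≤-trans (ℕₚ.+-cancelʳ-≤ (suc L ℕ.* (e ℕ.* c)) _ _ (begin
  (t ℕ.+ e) ℕ.* c ℕ.+ suc L ℕ.* (e ℕ.* c)        ≡⟨ ident₁ t e L c ⟩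
  (t ℕ.+ e ℕ.* K) ℕ.* c                           ≤⟨ ℕₚ.*-monoʳ-≤ (t ℕ.+ e ℕ.* K) cover ⟩
  (t ℕ.+ e ℕ.* K) ℕ.* (w ℕ.+ c′)                  ≡⟨ ident₂ t (e ℕ.* K) w c′ ⟩
  (t ℕ.+ e ℕ.* K) ℕ.* c′ ℕ.+ (t ℕ.* w ℕ.+ (e ℕ.* K) ℕ.* w) ≤⟨ ℕₚ.+-monoʳ-≤ ((t ℕ.+ e ℕ.* K) ℕ.* c′) (ℕₚ.+-mono-≤ tw≤ eKw≤) ⟩
  (t ℕ.+ e ℕ.* K) ℕ.* c′ ℕ.+ (L ℕ.* (e ℕ.* c) ℕ.+ e ℕ.* c) ≡⟨ cong ((t ℕ.+ e ℕ.* K) ℕ.* c′ ℕ.+_) (ℕₚ.+-comm (L ℕ.* (e ℕ.* c)) (e ℕ.* c)) ⟩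
  (t ℕ.+ e ℕ.* K) ℕ.* c′ ℕ.+ suc L ℕ.* (e ℕ.* c) ∎)) ih
  where
  K = suc (suc L)
  open ℕₚ.≤-Reasoning
  ident₁ : ∀ t e L c → (t ℕ.+ e) ℕ.* c ℕ.+ (1 ℕ.+ L) ℕ.* (e ℕ.* c) ≡ (t ℕ.+ e ℕ.* (2 ℕ.+ L)) ℕ.* c
  ident₁ = ℕsolve-∀
  ident₂ : ∀ t f w c → (t ℕ.+ f) ℕ.* (w ℕ.+ c) ≡ (t ℕ.+ f) ℕ.* c ℕ.+ (t ℕ.* w ℕ.+ f ℕ.* w)
  ident₂ = ℕsolve-∀
  ident₃ : ∀ L e q w → (L ℕ.* (e ℕ.* q)) ℕ.* w ≡ L ℕ.* (e ℕ.* (q ℕ.* w))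
  ident₃ = ℕsolve-∀
  tw≤ : t ℕ.* w ℕ.≤ L ℕ.* (e ℕ.* c)
  tw≤ = ℕₚ.≤-trans (ℕₚ.*-monoˡ-≤ w t≤) (ℕₚ.≤-trans (ℕₚ.≤-reflexive (ident₃ L e (K ℕ.* p) w)) (ℕₚ.*-monoʳ-≤ L (ℕₚ.*-monoʳ-≤ e small)))
  eKw≤ : (e ℕ.* K) ℕ.* w ℕ.≤ e ℕ.* c
  eKw≤ = ℕₚ.≤-trans (ℕₚ.≤-reflexive (ℕₚ.*-assoc e K w))
    (ℕₚ.*-monoʳ-≤ e (ℕₚ.≤-trans (ℕₚ.*-monoˡ-≤ w (ℕₚ.m≤m*n K p)) small))

-- The improvement from t to t + 1 and its iteration

module Bound {k} (λs : Vector ℤ (suc k)) (coprime : gcdᶠ λs ≡ 1) where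

  open Coprime λs coprime

  -- Lower bounds |S(A)| ≥ c|A| − O(1) are kept as t|A| ≤ E|S(A)| + C with c = t/E; each round raises t by one.
  L K N E : ℕ
  L = weight λs
  K = suc (suc L)
  N = Σℕ.sum d
  E = K ℕ.^ N

  f : List ℤ → ℕ
  f A = card (dil λs A)

  hitsAll-bound : (∀ i → ℕ.NonZero (d i)) →
    (∀ i → ∃ λ C → ∀ A → weight (removeAt λs i) ℕ.* card A ℕ.≤ d i ℕ.* card (dil (removeAt λs i) A) ℕ.+ C) →
    ∃ λ C → ∀ A → (∀ i → HitsAll (d i) A) → L ℕ.* card A ℕ.≤ f A ℕ.+ C
  hitsAll-bound nz ih = prodᶠ d ℕ.+ Cs , λ A hits → cancel k (nz zero) (f A) (begin
      k ℕ.* (L ℕ.* card A)              ≡⟨ sym (ℕₚ.*-assoc k L (card A)) ⟩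
      (k ℕ.* L) ℕ.* card A              ≡⟨ cong (ℕ._* card A) (sym (weight-remove λs)) ⟩
      Σℕ.sum (λ i → weight (removeAt λs i)) ℕ.* card A        ≡⟨ Σℕ.*-distribʳ-sum (card A) (λ i → weight (removeAt λs i)) ⟩
      Σℕ.sum (λ i → weight (removeAt λs i) ℕ.* card A)        ≤⟨ Σℕ-mono (λ i → proj₂ (ih i) A) ⟩
      Σℕ.sum (λ i → d i ℕ.* card (dil (removeAt λs i) A) ℕ.+ proj₁ (ih i))
                                         ≡⟨ Σℕ.∑-distrib-+ (λ i → d i ℕ.* card (dil (removeAt λs i) A)) (λ i → proj₁ (ih i)) ⟩
      Σℕ.sum (λ i → d i ℕ.* card (dil (removeAt λs i) A)) ℕ.+ Cs ≤⟨ ℕₚ.+-monoˡ-≤ Cs (Superadditivity.superadditivity nz A hits) ⟩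
      (k ℕ.* f A ℕ.+ prodᶠ d) ℕ.+ Cs    ≡⟨ ℕₚ.+-assoc (k ℕ.* f A) (prodᶠ d) Cs ⟩
      k ℕ.* f A ℕ.+ (prodᶠ d ℕ.+ Cs)    ∎)
    where
    open ℕₚ.≤-Reasoning
    Cs = Σℕ.sum (λ i → proj₁ (ih i))
    -- Nonzero `d zero` excludes k = 0, because the gcd of no numbers is 0.
    cancel : ∀ k {λs : Vector ℤ k} → ℕ.NonZero (gcdᶠ λs) → ∀ s {x C} → k ℕ.* x ℕ.≤ k ℕ.* s ℕ.+ C → x ℕ.≤ s ℕ.+ C
    cancel k@(suc _) _ s {x} {C} h = ℕₚ.*-cancelˡ-≤ k
      (ℕₚ.≤-trans h (ℕₚ.≤-trans (ℕₚ.+-monoʳ-≤ (k ℕ.* s) (ℕₚ.m≤n*m C k)) (ℕₚ.≤-reflexive (sym (ℕₚ.*-distribˡ-+ k s C)))))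

  -- A vanishing `λs i` would force `d i` to be 1, and mod 1 a nonempty set misses nothing.
  misses⇒λ≢0 : ∀ i {X x} → x ∈ X → Misses (d i) X → ℤ.NonZero (λs i)
  misses⇒λ≢0 i {x = x} x∈ (m , miss) = ℤ.≢-nonZero {λs i} λ e → miss x∈
    (d∣-cancel i (m - x) (subst (+ d i ∣_) (sym (cong (_* (m - x)) e)) (divides (+ 0) refl)))

  -- Take `a` in `A` from the class mod `d l` that `B` misses. As `λs l` is invertible mod `d l`, a
  -- sum determines its l-th coordinate mod `d l`; so the sums with `b` at `i` and `a` elsewhere are
  -- not in `dil λs B`.
  gain-other : ∀ i l → i ≢ l → .{{_ : ℤ.NonZero (λs i)}} → ∀ {A B} → (∀ {b} → b ∈ B → b ∈ A) →
    HitsAll (d l) A → Misses (d l) B → f B ℕ.+ card B ℕ.≤ card (mixed λs i B A)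
  gain-other i l i≢l {A} {B} B⊆A hits (m , miss) = go (hits m) (punchIn-surjective i≢l)
    where
    go : (∃ λ a → a ∈ A × + d l ∣ m - a) → (∃ λ l′ → punchIn i l′ ≡ l) → f B ℕ.+ card B ℕ.≤ card (mixed λs i B A)
    go (a , a∈ , m≈a) (l′ , refl) = ℕₚ.≤-trans
      (ℕₚ.+-monoʳ-≤ (f B) (card-injectiveOn {B} {map shift B} shift
        (λ {x} {y} _ _ e → ℤₚ.*-cancelˡ-≡ (λs i) x y (∙-cancelʳ w _ _ e)) (∈-map⁺ shift)))
      (card-disjoint {dil λs B} {map shift B} {mixed λs i B A} (dil⊆mixed λs i {A} {B} B⊆A) new⊆ disjoint)
      where
      v : Vector ℤ k
      v _ = a
      w = comb (removeAt λs i) v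
      shift : ℤ → ℤ
      shift b = λs i * b + w
      new⊆ : ∀ {u} → u ∈ map shift B → u ∈ mixed λs i B A
      new⊆ u∈ with ∈-map⁻ shift u∈
      ... | b , b∈ , refl = ∈-mixed⁺ λs i {A} {B} b∈ (∈-dil⁺ (removeAt λs i) v (λ _ → a∈))
      disjoint : ∀ {u} → u ∈ dil λs B → u ∈ map shift B → ⊥
      disjoint u∈ u∈new with ∈-map⁻ shift u∈new | ∈-dil⁻ λs u∈
      ... | b , _ , refl | c , c∈ , e = miss (c∈ l₀) (∣-chain m a (c l₀) m≈a
        (d∣-cancel l₀ (a - c l₀) (subst (+ d l₀ ∣_) (ident (comb λs c) (λs l₀) a (c l₀)) (∣m∣n⇒∣m-n coord₁ coord₂))))
        where
        l₀ = punchIn i l′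
        coord₁ : + d l₀ ∣ comb λs c - λs l₀ * c l₀
        coord₁ = ∣-comb-coordinate λs c l₀ (gcdᶠ-∣ (removeAt λs l₀))
        coord₂ : + d l₀ ∣ comb λs c - λs l₀ * a
        coord₂ = subst (+ d l₀ ∣_) (cong₂ (λ x y → x - λs l₀ * y) (trans (comb-insert λs v i b) e) (insertAt-punchIn v i b l′))
          (∣-comb-coordinate λs (insertAt v i b) l₀ (gcdᶠ-∣ (removeAt λs l₀)))
        ident : ∀ u l a c → (u - l * c) - (u - l * a) ≡ l * (a - c)
        ident = solve-∀

  module Improve (nz : ∀ i → ℕ.NonZero (d i)) (t : ℕ) (t< : suc t ℕ.≤ L ℕ.* E) (C : ℕ)
    (hyp : ∀ A → t ℕ.* card A ℕ.≤ E ℕ.* f A ℕ.+ C) where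

    module _ (i : Fin (suc k)) {{λ≢0 : ℤ.NonZero (λs i)}} (A : List ℤ) (gen : Generates A) where

      module _ (r : ℤ) where
        open Exit λs coprime i (nz i) A gen r using (affine; exit; gain)

        affine-injective : ∀ {x y} → affine x ≡ affine y → x ≡ y
        affine-injective {x} {y} e = ℤₚ.*-cancelˡ-≡ (+ d i) x y {{nz i}} (∙-cancelˡ r _ _ e)

        hyp-affine : ∀ X → t ℕ.* card X ℕ.≤ E ℕ.* f (map affine X) ℕ.+ C
        hyp-affine X = ℕₚ.≤-trans (ℕₚ.*-monoʳ-≤ t (card-injectiveOn {X} {map affine X} affine (λ _ _ → affine-injective) (∈-map⁺ affine)))
          (hyp (map affine X))

        -- Either the class of a leaving `x` is large enough for the gain, or it is deleted. The
        -- rest still misses a class mod `d i`, has one class fewer, and is given the target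
        -- `t + e * K`, which makes up for the deleted elements.
        missing-bound : ∀ n e R X → e ℕ.* K ℕ.^ n ≡ E → length R ≡ n → Covers (d i) R X → Misses (d i) X →
          (∀ {x} → x ∈ X → affine x ∈ A) →
          (t ℕ.+ e) ℕ.* card X ℕ.≤ E ℕ.* card (mixed λs i (map affine X) A) ℕ.+ C
        missing-bound n e R [] eK len cov miss X⊆ = ℕₚ.≤-trans (ℕₚ.≤-reflexive (ℕₚ.*-zeroʳ (t ℕ.+ e))) ℕ.z≤n
        missing-bound zero e [] (x ∷ X) eK len cov miss X⊆ with cov (here refl)
        ... | _ , () , _
        missing-bound (suc n) e R X@(_ ∷ _) eK len cov miss X⊆ = go (exit {X} (here refl) X⊆ miss)
          where
          W = dil (removeAt λs i) A
          go : (∃ λ x → ∃ λ w → x ∈ X × w ∈ W × Exit.Leaves λs coprime i (nz i) A gen r {X} (here refl) X⊆ x w) →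
            (t ℕ.+ e) ℕ.* card X ℕ.≤ E ℕ.* card (mixed λs i (map affine X) A) ℕ.+ C
          go (x , w , x∈ , w∈ , leaves) with card X ℕ.≤? K ℕ.^ suc n ℕ.* card (class (d i) x X)
          ... | yes large = large-class {t} {e} {K ℕ.^ suc n} eK large (gain {X} (here refl) X⊆ w∈ leaves) (hyp-affine X)
          ... | no ¬large = small-class {t} {e} {L} {K ℕ.^ n} {{ℕₚ.m^n≢0 K n}}
                (ℕₚ.≤-trans (ℕₚ.<⇒≤ t<) (ℕₚ.≤-reflexive (cong (L ℕ.*_) (sym eK)))) (ℕₚ.<⇒≤ (ℕₚ.≰⇒> ¬large))
                (card-class-others (d i) x X) (rest (covers-others (d i) cov x∈))
            where
            X′ = others (d i) x X
            others⊆ : ∀ {y} → y ∈ X′ → y ∈ X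
            others⊆ = proj₁ ∘ ∈-filter⁻ (λ y → ¬? (+ d i ∣? y - x)) {xs = X}
            images⊆ : ∀ {y} → y ∈ map affine X′ → y ∈ map affine X
            images⊆ y∈ with ∈-map⁻ affine y∈
            ... | z , z∈ , refl = ∈-map⁺ affine (others⊆ z∈)
            rest : (∃ λ R′ → length R ≡ suc (length R′) × Covers (d i) R′ X′) →
              (t ℕ.+ e ℕ.* K) ℕ.* card X′ ℕ.≤ E ℕ.* card (mixed λs i (map affine X) A) ℕ.+ C
            rest (R′ , len′ , cov′) = ℕₚ.≤-trans
              (missing-bound n (e ℕ.* K) R′ X′ (trans (ℕₚ.*-assoc e K (K ℕ.^ n)) eK) (ℕₚ.suc-injective (trans (sym len′) len)) cov′
                (proj₁ miss , proj₂ miss ∘ others⊆) (X⊆ ∘ others⊆))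
              (ℕₚ.+-monoˡ-≤ C (ℕₚ.*-monoʳ-≤ E (card-⊆ {mixed λs i (map affine X′) A} (mixed-mono λs i {A} images⊆))))

        class-bound : ∀ n → toℕ i ≡ n → (∀ l → suc n ℕ.≤ toℕ l → HitsAll (d l) A) → ∀ C′ →
          (∀ X → (∀ l → n ℕ.≤ toℕ l → HitsAll (d l) X) → suc t ℕ.* card X ℕ.≤ E ℕ.* f X ℕ.+ C′) →
          ∀ X → (∀ {x} → x ∈ X → affine x ∈ A) →
          suc t ℕ.* card X ℕ.≤ E ℕ.* card (mixed λs i (map affine X) A) ℕ.+ (C ℕ.+ C′)
        class-bound n i≡n hitsA C′ claim X X⊆ = cases (hitsAll? (d i) {{nz i}} X) (search decide)
          where
          B = map affine X
          T = card (mixed λs i B A)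
          B⊆A : ∀ {b} → b ∈ B → b ∈ A
          B⊆A b∈ with ∈-map⁻ affine b∈
          ... | x , x∈ , refl = X⊆ x∈
          decide : ∀ l → (suc n ℕ.≤ toℕ l → HitsAll (d l) B) ⊎ (suc n ℕ.≤ toℕ l × Misses (d l) B)
          decide l with suc n ℕ.≤? toℕ l | hitsAll? (d l) {{nz l}} B
          ... | no ¬p | _ = inj₁ λ p → contradiction p ¬p
          ... | yes _ | inj₁ h = inj₁ λ _ → h
          ... | yes p | inj₂ m = inj₂ (p , m)
          fB≤T : f B ℕ.≤ T
          fB≤T = card-⊆ {dil λs B} (dil⊆mixed λs i {A} {B} B⊆A)
          cases : HitsAll (d i) X ⊎ Misses (d i) X →
            (∀ l → suc n ℕ.≤ toℕ l → HitsAll (d l) B) ⊎ (∃ λ l → suc n ℕ.≤ toℕ l × Misses (d l) B) →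
            suc t ℕ.* card X ℕ.≤ E ℕ.* T ℕ.+ (C ℕ.+ C′)
          cases (inj₂ miss) _ = begin
            suc t ℕ.* card X         ≤⟨ ℕₚ.*-monoˡ-≤ (card X)
                (ℕₚ.≤-trans (ℕₚ.≤-reflexive (ℕₚ.+-comm 1 t)) (ℕₚ.+-monoʳ-≤ t (ℕₚ.m^n>0 K (N ℕ.∸ d i)))) ⟩
            (t ℕ.+ e) ℕ.* card X     ≤⟨ missing-bound (d i) e (residues (d i)) X eK
                (length-residues (d i)) (residues-covers (d i) {{nz i}} X) miss X⊆ ⟩
            E ℕ.* T ℕ.+ C            ≤⟨ ℕₚ.+-monoʳ-≤ (E ℕ.* T) (ℕₚ.m≤m+n C C′) ⟩
            E ℕ.* T ℕ.+ (C ℕ.+ C′)   ∎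
            where
            open ℕₚ.≤-Reasoning
            -- `d i` is a term of the sum `N`, so `K ^ d i` divides `E`; the quotient is at least 1,
            -- which suffices to pass from `t` to `suc t`.
            e = K ℕ.^ (N ℕ.∸ d i)
            eK : e ℕ.* K ℕ.^ d i ≡ E
            eK = trans (sym (ℕₚ.^-distribˡ-+-* K (N ℕ.∸ d i) (d i))) (cong (K ℕ.^_) (ℕₚ.m∸n+n≡m (≤-Σℕ d i)))
          cases (inj₁ _) (inj₂ (l , n<l , miss)) = begin
            suc t ℕ.* card X                    ≡⟨ ℕₚ.+-comm (card X) (t ℕ.* card X) ⟩
            t ℕ.* card X ℕ.+ card X             ≤⟨ ℕₚ.+-mono-≤ (hyp-affine X) card-X≤ ⟩
            (E ℕ.* f B ℕ.+ C) ℕ.+ E ℕ.* card B  ≡⟨ ident E (f B) C (card B) ⟩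
            E ℕ.* (f B ℕ.+ card B) ℕ.+ C        ≤⟨ ℕₚ.+-monoˡ-≤ C (ℕₚ.*-monoʳ-≤ E (gain-other i l i≢l {A} {B} B⊆A (hitsA l n<l) miss)) ⟩
            E ℕ.* T ℕ.+ C                       ≤⟨ ℕₚ.+-monoʳ-≤ (E ℕ.* T) (ℕₚ.m≤m+n C C′) ⟩
            E ℕ.* T ℕ.+ (C ℕ.+ C′)              ∎
            where
            open ℕₚ.≤-Reasoning
            ident : ∀ E f C w → (E ℕ.* f ℕ.+ C) ℕ.+ E ℕ.* w ≡ E ℕ.* (f ℕ.+ w) ℕ.+ C
            ident = ℕsolve-∀
            i≢l : i ≢ l
            i≢l e = ℕₚ.<-irrefl (trans (sym i≡n) (cong toℕ e)) n<l
            card-X≤ : card X ℕ.≤ E ℕ.* card B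
            card-X≤ = ℕₚ.≤-trans (card-injectiveOn {X} {B} affine (λ _ _ → affine-injective) (∈-map⁺ affine))
              (ℕₚ.m≤n*m (card B) E {{ℕₚ.m^n≢0 K N}})
          -- Nothing is gained over `f B` here, but the stronger claim applies to `X`, and `f X` is
          -- at most `f B`.
          cases (inj₁ hitsX) (inj₁ hitsB) = begin
            suc t ℕ.* card X         ≤⟨ claim X hits ⟩
            E ℕ.* f X ℕ.+ C′         ≤⟨ ℕₚ.+-mono-≤ (ℕₚ.*-monoʳ-≤ E (ℕₚ.≤-trans (card-dil-affine λs r (+ d i) {{nz i}} X) fB≤T)) (ℕₚ.m≤n+m C′ C) ⟩
            E ℕ.* T ℕ.+ (C ℕ.+ C′)   ∎
            where
            open ℕₚ.≤-Reasoning
            hits : ∀ l → n ℕ.≤ toℕ l → HitsAll (d l) X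
            hits l n≤l with ℕₚ.m≤n⇒m<n∨m≡n n≤l
            ... | inj₁ n<l = hitsAll-affine⁻ (d l) r (+ d i) X (hitsB l n<l)
            ... | inj₂ n≡l = subst (λ j → HitsAll (d j) X) (Finₚ.toℕ-injective (trans i≡n n≡l)) hitsX

      split-bound : ∀ C′ → (∀ r X → (∀ {x} → x ∈ X → r + + d i * x ∈ A) →
          suc t ℕ.* card X ℕ.≤ E ℕ.* card (mixed λs i (map (λ x → r + + d i * x) X) A) ℕ.+ C′) →
        ∀ n R X → length R ≡ n → Covers (d i) R X → (∀ {x} → x ∈ X → x ∈ A) →
        suc t ℕ.* card X ℕ.≤ E ℕ.* card (mixed λs i X A) ℕ.+ n ℕ.* C′
      split-bound C′ classes n R [] len cov X⊆ = ℕₚ.≤-trans (ℕₚ.≤-reflexive (ℕₚ.*-zeroʳ (suc t))) ℕ.z≤n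
      split-bound C′ classes zero [] (x ∷ X) len cov X⊆ with cov (here refl)
      ... | _ , () , _
      split-bound C′ classes (suc n) R X@(x ∷ _) len cov X⊆ = go (covers-others (d i) cov (here refl))
          (affine-preimage (+ d i) x B (λ b∈ → proj₂ (B⁻ b∈)))
        where
        open ℕₚ.≤-Reasoning
        B = class (d i) x X
        X′ = others (d i) x X
        B⁻ : ∀ {b} → b ∈ B → b ∈ X × + d i ∣ b - x
        B⁻ = ∈-filter⁻ (λ y → + d i ∣? y - x) {xs = X}
        X′⁻ : ∀ {y} → y ∈ X′ → y ∈ X × ¬ (+ d i ∣ y - x)
        X′⁻ = ∈-filter⁻ (λ y → ¬? (+ d i ∣? y - x)) {xs = X}
        -- Mod `d i` only the summand from `λs i` is visible, and it determines the class of its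
        -- element.
        disjoint : ∀ {u} → u ∈ mixed λs i B A → u ∈ mixed λs i X′ A → ⊥
        disjoint u∈ u∈′ with ∈-mixed⁻ λs i {A} {B} u∈ | ∈-mixed⁻ λs i {A} {X′} u∈′
        ... | b , s , b∈ , s∈ , refl | y , s′ , y∈ , s′∈ , e = proj₂ (X′⁻ y∈)
          (∣-chain y b x (d∣-cancel i (y - b) (subst (+ d i ∣_) (ident e) (∣m∣n⇒∣m-n (∣-dil i s∈) (∣-dil i s′∈)))) (proj₂ (B⁻ b∈)))
          where
          rearrange : ∀ l b y s s′ → s - s′ ≡ ((l * b + s) - (l * y + s′)) + l * (y - b)
          rearrange = solve-∀
          ident : λs i * b + s ≡ λs i * y + s′ → s - s′ ≡ λs i * (y - b)
          ident e = trans (rearrange (λs i) b y s s′) (trans (cong (λ z → (z - (λs i * y + s′)) + λs i * (y - b)) e)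
            (trans (cong (_+ λs i * (y - b)) (ℤₚ.+-inverseʳ (λs i * y + s′))) (ℤₚ.+-identityˡ _)))
        go : (∃ λ R′ → length R ≡ suc (length R′) × Covers (d i) R′ X′) → (∃ λ Y → B ≡ map (λ z → x + + d i * z) Y) →
          suc t ℕ.* card X ℕ.≤ E ℕ.* card (mixed λs i X A) ℕ.+ suc n ℕ.* C′
        go (R′ , len′ , cov′) (Y , B≡) = begin
          suc t ℕ.* card X                           ≤⟨ ℕₚ.*-monoʳ-≤ (suc t) (card-class-others (d i) x X) ⟩
          suc t ℕ.* (card B ℕ.+ card X′)             ≡⟨ ℕₚ.*-distribˡ-+ (suc t) (card B) (card X′) ⟩
          suc t ℕ.* card B ℕ.+ suc t ℕ.* card X′     ≤⟨ ℕₚ.+-mono-≤ B-bound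
              (split-bound C′ classes n R′ X′ (ℕₚ.suc-injective (trans (sym len′) len)) cov′ (λ y∈ → X⊆ (proj₁ (X′⁻ y∈)))) ⟩
          (E ℕ.* TB ℕ.+ C′) ℕ.+ (E ℕ.* TX′ ℕ.+ n ℕ.* C′) ≡⟨ ident E TB TX′ C′ n ⟩
          E ℕ.* (TB ℕ.+ TX′) ℕ.+ (C′ ℕ.+ n ℕ.* C′)   ≤⟨ ℕₚ.+-monoˡ-≤ (suc n ℕ.* C′) (ℕₚ.*-monoʳ-≤ E
              (card-disjoint {mixed λs i B A} {mixed λs i X′ A} {mixed λs i X A}
              (mixed-mono λs i {A} {B} {X} (λ b∈ → proj₁ (B⁻ b∈))) (mixed-mono λs i {A} {X′} {X} (λ y∈ → proj₁ (X′⁻ y∈))) disjoint)) ⟩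
          E ℕ.* card (mixed λs i X A) ℕ.+ suc n ℕ.* C′ ∎
          where
          TB = card (mixed λs i B A)
          TX′ = card (mixed λs i X′ A)
          ident : ∀ E a b C n → (E ℕ.* a ℕ.+ C) ℕ.+ (E ℕ.* b ℕ.+ n ℕ.* C) ≡ E ℕ.* (a ℕ.+ b) ℕ.+ (C ℕ.+ n ℕ.* C)
          ident = ℕsolve-∀
          Y⊆ : ∀ {y} → y ∈ Y → x + + d i * y ∈ A
          Y⊆ y∈ = X⊆ (proj₁ (B⁻ (subst (_ ∈_) (sym B≡) (∈-map⁺ (λ z → x + + d i * z) y∈))))
          B-bound : suc t ℕ.* card B ℕ.≤ E ℕ.* TB ℕ.+ C′
          B-bound = ℕₚ.≤-trans (ℕₚ.*-monoʳ-≤ (suc t) (subst (λ Z → card Z ℕ.≤ card Y) (sym B≡) (card-map≤ (λ z → x + + d i * z) Y)))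
            (subst (λ Z → suc t ℕ.* card Y ℕ.≤ E ℕ.* card (mixed λs i Z A) ℕ.+ C′) (sym B≡) (classes x Y Y⊆))

    -- For n = 0 this follows from superadditivity; for n = k + 1 no condition on `A` remains.
    ClaimFrom : ℕ → Set
    ClaimFrom n = ∃ λ C′ → ∀ A → (∀ l → n ℕ.≤ toℕ l → HitsAll (d l) A) → suc t ℕ.* card A ℕ.≤ E ℕ.* f A ℕ.+ C′

    generating-bound : ∀ i C′ → (∀ A → (∀ l → toℕ i ℕ.≤ toℕ l → HitsAll (d l) A) → suc t ℕ.* card A ℕ.≤ E ℕ.* f A ℕ.+ C′) →
      ∀ X → Generates X → (∀ l → suc (toℕ i) ℕ.≤ toℕ l → HitsAll (d l) X) →
      suc t ℕ.* card X ℕ.≤ E ℕ.* f X ℕ.+ (C′ ℕ.+ d i ℕ.* (C ℕ.+ C′))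
    generating-bound i C′ claim [] gen hits = ℕₚ.≤-trans (ℕₚ.≤-reflexive (ℕₚ.*-zeroʳ (suc t))) ℕ.z≤n
    generating-bound i C′ claim X@(_ ∷ _) gen hits with hitsAll? (d i) {{nz i}} X
    ... | inj₁ h = ℕₚ.≤-trans (claim X hits′) (ℕₚ.+-monoʳ-≤ (E ℕ.* f X) (ℕₚ.m≤m+n C′ _))
      where
      hits′ : ∀ l → toℕ i ℕ.≤ toℕ l → HitsAll (d l) X
      hits′ l i≤l with ℕₚ.m≤n⇒m<n∨m≡n i≤l
      ... | inj₁ i<l = hits l i<l
      ... | inj₂ i≡l = subst (λ j → HitsAll (d j) X) (Finₚ.toℕ-injective i≡l) h
    ... | inj₂ miss = ℕₚ.≤-trans
      (split-bound i {{λ≢0}} X gen (C ℕ.+ C′) (λ r → class-bound i {{λ≢0}} X gen r (toℕ i) refl hits C′ claim)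
        (d i) (residues (d i)) X (length-residues (d i)) (residues-covers (d i) {{nz i}} X) id)
      (ℕₚ.+-mono-≤ (ℕₚ.*-monoʳ-≤ E (card-⊆ {mixed λs i X X} {dil λs X} (mixed⊆dil λs i {X} {X} id))) (ℕₚ.m≤n+m _ C′))
      where λ≢0 = misses⇒λ≢0 i {X} (here refl) miss

    claim-step : ∀ i → ClaimFrom (toℕ i) → ClaimFrom (suc (toℕ i))
    claim-step i (C′ , claim) = C″ , λ
      { [] _ → ℕₚ.≤-trans (ℕₚ.≤-reflexive (ℕₚ.*-zeroʳ (suc t))) ℕ.z≤n
      ; A@(a₀ ∷ _) hits → cases A a₀ hits (normalise {A} {a₀} (here refl)) }
      where
      open ℕₚ.≤-Reasoning
      m = d i ℕ.* (C ℕ.+ C′)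
      -- The term `suc t` pays for the sets with one element, which cannot be rescaled to generate
      -- ℤ.
      C″ = suc t ℕ.+ (C′ ℕ.+ m)
      cases : ∀ A a₀ → (∀ l → suc (toℕ i) ℕ.≤ toℕ l → HitsAll (d l) A) →
        (∀ {a} → a ∈ A → a ≡ a₀) ⊎ (∃ λ q → ∃ λ X → ℕ.NonZero q × A ≡ map (λ x → a₀ + + q * x) X × Generates X) →
        suc t ℕ.* card A ℕ.≤ E ℕ.* f A ℕ.+ C″
      cases A a₀ hits (inj₁ single) = begin
        suc t ℕ.* card A      ≤⟨ ℕₚ.*-monoʳ-≤ (suc t) (card-⊆ {A} {a₀ ∷ []} (here ∘ single)) ⟩
        suc t ℕ.* 1           ≡⟨ ℕₚ.*-identityʳ (suc t) ⟩
        suc t                 ≤⟨ ℕₚ.m≤m+n (suc t) _ ⟩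
        C″                    ≤⟨ ℕₚ.m≤n+m C″ _ ⟩
        E ℕ.* f A ℕ.+ C″     ∎
      cases A a₀ hits (inj₂ (q , X , q≢0 , refl , gen)) = begin
        suc t ℕ.* card A      ≤⟨ ℕₚ.*-monoʳ-≤ (suc t) (card-map≤ (λ x → a₀ + + q * x) X) ⟩
        suc t ℕ.* card X      ≤⟨ generating-bound i C′ claim X gen (λ l p → hitsAll-affine⁻ (d l) a₀ (+ q) X (hits l p)) ⟩
        E ℕ.* f X ℕ.+ (C′ ℕ.+ m) ≤⟨ ℕₚ.+-mono-≤ (ℕₚ.*-monoʳ-≤ E (card-dil-affine λs a₀ (+ q) {{q≢0}} X)) (ℕₚ.m≤n+m (C′ ℕ.+ m) (suc t)) ⟩
        E ℕ.* f A ℕ.+ C″     ∎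
    claims : ClaimFrom 0 → ∀ n → n ℕ.≤ suc k → ClaimFrom n
    claims c zero _ = c
    claims c (suc n) n<k = subst (ClaimFrom ∘ suc) (Finₚ.toℕ-fromℕ< n<k)
      (claim-step (fromℕ< n<k) (subst ClaimFrom (sym (Finₚ.toℕ-fromℕ< n<k)) (claims c n (ℕₚ.<⇒≤ n<k))))

    improve : ∀ C₀ → (∀ A → (∀ i → HitsAll (d i) A) → L ℕ.* card A ℕ.≤ f A ℕ.+ C₀) →
      ∃ λ C′ → ∀ A → suc t ℕ.* card A ℕ.≤ E ℕ.* f A ℕ.+ C′
    improve C₀ base = let C′ , claim = claims base′ (suc k) ℕₚ.≤-refl in
      C′ , λ A → claim A λ l k<l → contradiction k<l (ℕₚ.<⇒≱ (Finₚ.toℕ<n l))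
      where
      open ℕₚ.≤-Reasoning
      base′ : ClaimFrom 0
      base′ = E ℕ.* C₀ , λ A hits → begin
        suc t ℕ.* card A         ≤⟨ ℕₚ.*-monoˡ-≤ (card A) t< ⟩
        (L ℕ.* E) ℕ.* card A     ≡⟨ trans (cong (ℕ._* card A) (ℕₚ.*-comm L E)) (ℕₚ.*-assoc E L (card A)) ⟩
        E ℕ.* (L ℕ.* card A)     ≤⟨ ℕₚ.*-monoʳ-≤ E (base A (λ i → hits i ℕ.z≤n)) ⟩
        E ℕ.* (f A ℕ.+ C₀)       ≡⟨ ℕₚ.*-distribˡ-+ E (f A) C₀ ⟩
        E ℕ.* f A ℕ.+ E ℕ.* C₀   ∎

  bootstrap : (∀ i → ℕ.NonZero (d i)) → (∃ λ C → ∀ A → (∀ i → HitsAll (d i) A) → L ℕ.* card A ℕ.≤ f A ℕ.+ C) →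
    ∃ λ C → ∀ A → L ℕ.* card A ℕ.≤ f A ℕ.+ C
  bootstrap nz (C₀ , base) = let C , bound = go (L ℕ.* E) ℕₚ.≤-refl in C , λ A →
    ℕₚ.*-cancelˡ-≤ E {{ℕₚ.m^n≢0 K N}} (begin
      E ℕ.* (L ℕ.* card A)     ≡⟨ trans (sym (ℕₚ.*-assoc E L (card A))) (cong (ℕ._* card A) (ℕₚ.*-comm E L)) ⟩
      (L ℕ.* E) ℕ.* card A     ≤⟨ bound A ⟩
      E ℕ.* f A ℕ.+ C          ≤⟨ ℕₚ.+-monoʳ-≤ (E ℕ.* f A) (ℕₚ.m≤n*m C E {{ℕₚ.m^n≢0 K N}}) ⟩
      E ℕ.* f A ℕ.+ E ℕ.* C    ≡⟨ sym (ℕₚ.*-distribˡ-+ E (f A) C) ⟩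
      E ℕ.* (f A ℕ.+ C)        ∎)
    where
    open ℕₚ.≤-Reasoning
    go : ∀ t → t ℕ.≤ L ℕ.* E → ∃ λ C → ∀ A → t ℕ.* card A ℕ.≤ E ℕ.* f A ℕ.+ C
    go zero _ = 0 , λ _ → ℕ.z≤n
    go (suc t) t< = let C , hyp = go t (ℕₚ.<⇒≤ t<) in Improve.improve nz t t< C hyp C₀ base

-- Induction on the number of coefficients

single-coefficient-bound : ∀ {k} (λs : Vector ℤ (suc k)) i .{{_ : ℤ.NonZero (λs i)}} A → card A ℕ.≤ card (dil λs A)
single-coefficient-bound λs i [] = ℕ.z≤n
single-coefficient-bound λs i A@(a ∷ _) = card-injectiveOn {A} {dil λs A} (λ x → λs i * x + w)
  (λ {x} {y} _ _ e → ℤₚ.*-cancelˡ-≡ (λs i) x y (∙-cancelʳ w _ _ e))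
  (λ x∈ → mixed⊆dil λs i {A} {A} id (∈-mixed⁺ λs i {A} {A} x∈ (∈-dil⁺ (removeAt λs i) (λ _ → a) (λ _ → here refl))))
  where
  w = comb (removeAt λs i) (λ _ → a)

-- The factor `gcdᶠ λs` makes both sides scale alike when all coefficients are multiplied by a
-- nonzero integer.
UpToConstant : ∀ {k} → Vector ℤ k → Set
UpToConstant λs = ∃ λ C → ∀ A → weight λs ℕ.* card A ℕ.≤ gcdᶠ λs ℕ.* card (dil λs A) ℕ.+ C

coprime-bound : ∀ {k} (λs : Vector ℤ (suc k)) → gcdᶠ λs ≡ 1 → (∀ i → UpToConstant (removeAt λs i)) →
  ∃ λ C → ∀ A → weight λs ℕ.* card A ℕ.≤ card (dil λs A) ℕ.+ C
coprime-bound λs coprime ih = cases (search decide)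
  where
  open Coprime λs coprime
  open Bound λs coprime using (hitsAll-bound; bootstrap)
  decide : ∀ i → ℕ.NonZero (d i) ⊎ d i ≡ 0
  decide i with d i
  ... | zero = inj₂ refl
  ... | suc _ = inj₁ _
  cases : (∀ i → ℕ.NonZero (d i)) ⊎ (∃ λ i → d i ≡ 0) → ∃ λ C → ∀ A → weight λs ℕ.* card A ℕ.≤ card (dil λs A) ℕ.+ C
  cases (inj₁ nz) = bootstrap nz (hitsAll-bound nz ih)
  -- All other coefficients vanish, so `λs i` is 1 or -1. The induction hypothesis, with its factor
  -- `d i` equal to 0, absorbs the remaining weight into the constant. This includes the case of one
  -- coefficient.
  cases (inj₂ (i , dᵢ≡0)) = C , λ A → begin
    weight λs ℕ.* card A                                        ≡⟨ cong (ℕ._* card A) (Σℕ.sum-remove {i = i} (λ j → abs (λs j))) ⟩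
    (abs (λs i) ℕ.+ weight (removeAt λs i)) ℕ.* card A          ≡⟨ ℕₚ.*-distribʳ-+ (card A) (abs (λs i)) _ ⟩
    abs (λs i) ℕ.* card A ℕ.+ weight (removeAt λs i) ℕ.* card A ≤⟨ ℕₚ.+-mono-≤
        (ℕₚ.≤-trans (ℕₚ.≤-reflexive (trans (cong (ℕ._* card A) ∣λᵢ∣≡1) (ℕₚ.*-identityˡ (card A)))) (single-coefficient-bound λs i {{λᵢ≢0}} A))
        (subst (λ e → weight (removeAt λs i) ℕ.* card A ℕ.≤ e ℕ.* card (dil (removeAt λs i) A) ℕ.+ C) dᵢ≡0 (proj₂ (ih i) A)) ⟩
    card (dil λs A) ℕ.+ C                                       ∎
    where
    open ℕₚ.≤-Reasoning
    C = proj₁ (ih i)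
    member : ∀ j → λs i ∣ λs j
    member j with i Finₚ.≟ j
    ... | yes refl = ∣-refl
    ... | no i≢j = subst (λs i ∣_) (sym (0∣⇒≡0 (subst (λ e → + e ∣ λs j) dᵢ≡0 (d∣ i≢j)))) (divides (+ 0) refl)
    ∣λᵢ∣≡1 : abs (λs i) ≡ 1
    ∣λᵢ∣≡1 = ℕ∣.∣1⇒≡1 (∣⇒∣ᵤ (1-closed (∣-subgroup (λs i)) member))
    λᵢ≢0 : ℤ.NonZero (λs i)
    λᵢ≢0 = subst ℕ.NonZero (sym ∣λᵢ∣≡1) _

weight-scale : ∀ {k} (λs μs : Vector ℤ k) g → (∀ i → λs i ≡ + g * μs i) → weight λs ≡ g ℕ.* weight μs
weight-scale λs μs g e = trans (Σℕ.sum-cong-≗ λ i → trans (cong abs (e i)) (ℤₚ.abs-* (+ g) (μs i))) (sym (Σℕ.*-distribˡ-sum g (λ i → abs (μs i))))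

gcdᶠ-scale : ∀ {k} (λs μs : Vector ℤ k) .{{_ : ℕ.NonZero (gcdᶠ λs)}} → (∀ i → λs i ≡ + gcdᶠ λs * μs i) → gcdᶠ μs ≡ 1
gcdᶠ-scale λs μs e = ℕ∣.∣1⇒≡1 (∣⇒∣ᵤ (*-cancelˡ-∣ (+ gcdᶠ λs) (subst (+ gcdᶠ λs * + gcdᶠ μs ∣_) (sym (ℤₚ.*-identityʳ (+ gcdᶠ λs)))
  (gcdᶠ-closed (∣-subgroup (+ gcdᶠ λs * + gcdᶠ μs)) λs
    λ i → subst (+ gcdᶠ λs * + gcdᶠ μs ∣_) (sym (e i)) (*-monoʳ-∣ (+ gcdᶠ λs) (gcdᶠ-∣ μs i))))))

upToConstant : ∀ {k} (λs : Vector ℤ k) → UpToConstant λs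
upToConstant {zero} λs = 0 , λ _ → ℕ.z≤n
upToConstant {suc k} λs with gcdᶠ λs in eq
... | zero = 0 , λ A → ℕₚ.≤-reflexive (cong (ℕ._* card A) (weight-scale λs (λ _ → + 0) 0 λ i →
        0∣⇒≡0 (subst (λ g → + g ∣ λs i) eq (gcdᶠ-∣ λs i))))
... | g@(suc _) = scale (coprime-bound μs (gcdᶠ-scale λs μs {{subst ℕ.NonZero (sym eq) _}} λ i → trans (λ≡ i) (cong (λ g → + g * μs i) (sym eq)))
        λ i → upToConstant (removeAt μs i))
  where
  open ℕₚ.≤-Reasoning
  g∣ : ∀ i → + g ∣ λs i
  g∣ i = subst (λ g → + g ∣ λs i) eq (gcdᶠ-∣ λs i)
  μs : Vector ℤ (suc k)
  μs i = quotient (g∣ i)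
  λ≡ : ∀ i → λs i ≡ + g * μs i
  λ≡ i = trans (_∣_.equality (g∣ i)) (ℤₚ.*-comm (μs i) (+ g))
  scale : (∃ λ C → ∀ A → weight μs ℕ.* card A ℕ.≤ card (dil μs A) ℕ.+ C) →
    ∃ λ C → ∀ A → weight λs ℕ.* card A ℕ.≤ g ℕ.* card (dil λs A) ℕ.+ C
  scale (C , bound) = g ℕ.* C , λ A → begin
    weight λs ℕ.* card A                     ≡⟨ trans (cong (ℕ._* card A) (weight-scale λs μs g λ≡)) (ℕₚ.*-assoc g (weight μs) (card A)) ⟩
    g ℕ.* (weight μs ℕ.* card A)             ≤⟨ ℕₚ.*-monoʳ-≤ g (ℕₚ.≤-trans (bound A) (ℕₚ.+-monoˡ-≤ C (card-dil-scale λs μs (+ g) λ≡ A))) ⟩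
    g ℕ.* (card (dil λs A) ℕ.+ C)            ≡⟨ ℕₚ.*-distribˡ-+ g (card (dil λs A)) C ⟩
    g ℕ.* card (dil λs A) ℕ.+ g ℕ.* C        ∎

-- Translation to the given definitions

dilSum≡dil : ∀ {k} (lam : Vec ℤ k) A → dilSum lam A ≡ dil (lookup lam) A
dilSum≡dil V.[] A = refl
dilSum≡dil (l V.∷ lam) A = cong ((l · A) ⊕_) (dilSum≡dil lam A)

gcdVec≡gcdᶠ : ∀ {k} (lam : Vec ℤ k) → gcdVec lam ≡ + gcdᶠ (lookup lam)
gcdVec≡gcdᶠ V.[] = refl
gcdVec≡gcdᶠ (l V.∷ lam) = cong (λ g → + GCD.gcd (abs l) (abs g)) (gcdVec≡gcdᶠ lam)

absSum≡weight : ∀ {k} (lam : Vec ℤ k) → absSum lam ≡ weight (lookup lam)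
absSum≡weight V.[] = refl
absSum≡weight (l V.∷ lam) = cong (abs l ℕ.+_) (absSum≡weight lam)

theorem1p1 : (k : ℕ) → 1 ℕ.≤ k → (lam : Vec ℤ k) → gcdVec lam ≡ + 1 →
    ∃ λ (C : ℤ) → (A : List ℤ) →
    + (absSum lam ℕ.* card A) ℤ.- C ℤ.≤ + card (dilSum lam A)
theorem1p1 k _ lam coprime = let C , bound = upToConstant (lookup lam) in + C , λ A →
  subst (+ (absSum lam ℕ.* card A) - + C ℤ.≤_) (cancel (+ card (dilSum lam A)) (+ C))
    (ℤₚ.+-monoˡ-≤ (- + C) (ℤ.+≤+ (translate C A (bound A))))
  where
  open ℕₚ.≤-Reasoning
  cancel : ∀ x y → (x + y) - y ≡ x
  cancel = solve-∀
  g≡1 : gcdᶠ (lookup lam) ≡ 1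
  g≡1 = ℤₚ.+-injective (trans (sym (gcdVec≡gcdᶠ lam)) coprime)
  translate : ∀ C A → weight (lookup lam) ℕ.* card A ℕ.≤ gcdᶠ (lookup lam) ℕ.* card (dil (lookup lam) A) ℕ.+ C →
    absSum lam ℕ.* card A ℕ.≤ card (dilSum lam A) ℕ.+ C
  translate C A h = begin
    absSum lam ℕ.* card A                                         ≡⟨ cong (ℕ._* card A) (absSum≡weight lam) ⟩
    weight (lookup lam) ℕ.* card A                                ≤⟨ h ⟩
    gcdᶠ (lookup lam) ℕ.* card (dil (lookup lam) A) ℕ.+ C         ≡⟨ cong₂ (λ g B → g ℕ.* card B ℕ.+ C) g≡1 (sym (dilSum≡dil lam A)) ⟩
    1 ℕ.* card (dilSum lam A) ℕ.+ C                               ≡⟨ cong (ℕ._+ C) (ℕₚ.*-identityˡ (card (dilSum lam A))) ⟩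
    card (dilSum lam A) ℕ.+ C                                     ∎
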